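{- Ambiguous çarks correspond to ambiguous forms: a çark $\mathcal{C}$ is ambiguous (that is, $\mathcal{C}$ and $\mathcal{C}^{r}$ are isomorphic as çarks) if and only if the forms in the class represented by $\mathcal{C}$ are ambiguous.
   Context: Let $S(z)=-1/z$, $R(z)=(z-1)/z$. The bipartite Farey tree $\mathcal{F}$ has edges $\{W\}$, $\otimes$-vertices $\{W,WS\}$, $\bullet$-vertices $\{W,WR,WR^2\}$ ($W\in\mathrm{PSL}_2(\mathbf{Z})$); the edge $\{W\}$ joins $\{W,WS\}$ to $\{W,WR,WR^2\}$. $\mathrm{PSL}_2(\mathbf{Z})$ acts on it by left multiplication. $\mathcal{F}$ is realized in the upper half plane $\mathcal{H}$ as the orbit of the geodesic arc from $i$ (the vertex $\{I,S\}$) to $e^{i\pi/3}$ (the vertex $\{I,R,R^2\}$). A çark is $\langle M\rangle\backslash\mathcal{F}$ with $M\in \mathrm{PSL}_2(\mathbf{Z})$ hyperbolic, embedded in the annulus $\langle M\rangle\backslash\mathcal{H}$; its unique circuit, the image of the axis of $M$ in $\mathcal{F}$, is the spine, directed by the translation direction of $M$. The annulus is viewed, compatibly with orientation, as a round annulus in the plane with the spine running counterclockwise, so the inner boundary is to the left of the directed spine. All çarks here are considered with this convention, and isomorphisms of çarks preserve the ribbon structure and the direction of the spine (hence inner and outer boundary). At each $\bullet$-vertex of the spine an infinite Farey branch is attached, going to the inner or the outer boundary. A çark is thus determined by the cyclic word in the letters "inner", "outer" read along the counterclockwise spine. $\mathcal{C}^r$ is the mirror image of $\mathcal{C}$ about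 a line through the centre of the spine (branches drawn evenly spaced): the cyclic word is reversed, inner/outer are kept, and the spine is again directed counterclockwise. $\mathcal{C}$ is ambiguous if $\mathcal{C}\cong\mathcal{C}^r$. Forms: $(A,B,C)$ denotes $Ax^2+Bxy+Cy^2$ with $A,B,C\in\mathbf{Z}$, and $\mathrm{PSL}_2(\mathbf{Z})$ acts by $(U\cdot f)(x,y)=f(U(x,y)^t)$; classes are orbits. For hyperbolic $M=\begin{pmatrix}p&q\\ r&s\end{pmatrix}$ put $f_M=\frac{\mathrm{sgn}(p+s)}{\gcd(q,s-p,r)}(r,s-p,-q)$, a primitive indefinite form; the çark $\langle M\rangle\backslash\mathcal{F}$ directed by $M$ represents the class $[f_M]$. The inverse of the class of $(A,B,C)$ is the class of $(A,-B,C)$. A form is ambiguous if it is equivalent to its inverse, or equivalently if its class contains a form $(a,ka,c)$ with $a,c,k\in\mathbf{Z}$. -}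

module Defs where

open import Algebra.Bundles using (Group)
open import Data.Integer.Base
  using (ℤ; +_; -[1+_]; _+_; _*_; _-_; -_; ∣_∣; 0ℤ; 1ℤ; NonZero; ≢-nonZero; sign; _◃_)
import Data.Integer.Base as ℤ
open import Data.Integer.DivMod using (_/_)
open import Data.Integer.GCD using (gcd; gcd[i,j]≡0⇒i≡0)
import Data.Integer.Properties as ℤₚ
open import Data.Integer.Tactic.RingSolver using (solve-∀)
open import Data.Nat.Base as ℕ using (ℕ; zero; suc)
import Data.Nat.Properties as ℕₚ
open import Data.Product.Base using (_×_; _,_; ∃-syntax; Σ-syntax)
open import Function.Bundles using (Inverse; _⇔_)
import Function.Construct.Symmetry as Symmetry
open import Level using (0ℓ)
open import Relation.Binary.Bundles using (Setoid)
open import Relation.Binary.Structures using (IsEquivalence)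
open import Relation.Binary.PropositionalEquality
  using (_≡_; refl; sym; trans; cong; cong₂; subst)
open import Relation.Nullary using (¬_)

------------------------------------------------------------------------
-- The modular group

record Mat : Set where
  constructor mat
  field p q r s : ℤ

det : Mat → ℤ
det (mat p q r s) = p * s - q * r

infixl 7 _⊡_
_⊡_ : Mat → Mat → Mat
mat p q r s ⊡ mat p′ q′ r′ s′ =
  mat (p * p′ + q * r′) (p * q′ + q * s′) (r * p′ + s * r′) (r * q′ + s * s′)

neg : Mat → Mat
neg (mat p q r s) = mat (- p) (- q) (- r) (- s)

adj : Mat → Mat
adj (mat p q r s) = mat s (- q) (- r) p

record SL₂ℤ : Set where
  constructor _,_
  field
    matrix : Mat
    det≡1  : det matrix ≡ 1ℤ

open SL₂ℤ public

-- Equality in PSL₂(ℤ): the elements are matrices up to sign.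
infix 4 _≈_
data _≈_ (A B : SL₂ℤ) : Set where
  same     : matrix A ≡ matrix B → A ≈ B
  opposite : matrix A ≡ neg (matrix B) → A ≈ B

private
  one : Mat
  one = mat 1ℤ 0ℤ 0ℤ 1ℤ

  abstract
    mat≡ : ∀ {p q r s p′ q′ r′ s′} → p ≡ p′ → q ≡ q′ → r ≡ r′ → s ≡ s′ →
           mat p q r s ≡ mat p′ q′ r′ s′
    mat≡ refl refl refl refl = refl

    neg-neg : ∀ A → neg (neg A) ≡ A
    neg-neg (mat p q r s) = mat≡ (ℤₚ.neg-involutive p) (ℤₚ.neg-involutive q)
                                 (ℤₚ.neg-involutive r) (ℤₚ.neg-involutive s)

    ⊡-assoc : ∀ A B C → (A ⊡ B) ⊡ C ≡ A ⊡ (B ⊡ C)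
    ⊡-assoc (mat a b c d) (mat e f g h) (mat i j k l) =
      mat≡ (entry a b e f g h i k) (entry a b e f g h j l)
           (entry c d e f g h i k) (entry c d e f g h j l)
      where
      entry : ∀ a b e f g h i k →
        (a * e + b * g) * i + (a * f + b * h) * k ≡ a * (e * i + f * k) + b * (g * i + h * k)
      entry = solve-∀

    neg-⊡ˡ : ∀ A B → neg A ⊡ B ≡ neg (A ⊡ B)
    neg-⊡ˡ (mat a b c d) (mat e f g h) =
      mat≡ (entry a b e g) (entry a b f h) (entry c d e g) (entry c d f h)
      where
      entry : ∀ a b e g → (- a) * e + (- b) * g ≡ - (a * e + b * g)
      entry = solve-∀

    neg-⊡ʳ : ∀ A B → A ⊡ neg B ≡ neg (A ⊡ B)
    neg-⊡ʳ (mat a b c d) (mat e f g h) =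
      mat≡ (entry a b e g) (entry a b f h) (entry c d e g) (entry c d f h)
      where
      entry : ∀ a b e g → a * (- e) + b * (- g) ≡ - (a * e + b * g)
      entry = solve-∀

    neg-adj : ∀ A → adj (neg A) ≡ neg (adj A)
    neg-adj (mat p q r s) = refl

    det-⊡ : ∀ A B → det (A ⊡ B) ≡ det A * det B
    det-⊡ (mat a b c d) (mat e f g h) = lemma a b c d e f g h
      where
      lemma : ∀ a b c d e f g h →
        (a * e + b * g) * (c * f + d * h) - (a * f + b * h) * (c * e + d * g)
          ≡ (a * d - b * c) * (e * h - f * g)
      lemma = solve-∀

    det-adj : ∀ A → det (adj A) ≡ det A
    det-adj (mat a b c d) = lemma a b c d
      where
      lemma : ∀ a b c d → d * a - (- b) * (- c) ≡ a * d - b * c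
      lemma = solve-∀

    ⊡-identityˡ : ∀ A → one ⊡ A ≡ A
    ⊡-identityˡ (mat a b c d) = mat≡ (e₁ a c) (e₁ b d) (e₂ a c) (e₂ b d)
      where
      e₁ : ∀ a c → 1ℤ * a + 0ℤ * c ≡ a
      e₁ = solve-∀
      e₂ : ∀ a c → 0ℤ * a + 1ℤ * c ≡ c
      e₂ = solve-∀

    ⊡-identityʳ : ∀ A → A ⊡ one ≡ A
    ⊡-identityʳ (mat a b c d) = mat≡ (e₁ a b) (e₂ a b) (e₁ c d) (e₂ c d)
      where
      e₁ : ∀ a b → a * 1ℤ + b * 0ℤ ≡ a
      e₁ = solve-∀
      e₂ : ∀ a b → a * 0ℤ + b * 1ℤ ≡ b
      e₂ = solve-∀

    adj-inverseˡ : ∀ A → det A ≡ 1ℤ → adj A ⊡ A ≡ one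
    adj-inverseˡ (mat a b c d) eq =
      mat≡ (trans (e₁ a b c d) eq) (e₂ b d) (e₃ a c) (trans (e₄ a b c d) eq)
      where
      e₁ : ∀ a b c d → d * a + (- b) * c ≡ a * d - b * c
      e₁ = solve-∀
      e₂ : ∀ b d → d * b + (- b) * d ≡ 0ℤ
      e₂ = solve-∀
      e₃ : ∀ a c → (- c) * a + a * c ≡ 0ℤ
      e₃ = solve-∀
      e₄ : ∀ a b c d → (- c) * b + a * d ≡ a * d - b * c
      e₄ = solve-∀

    adj-inverseʳ : ∀ A → det A ≡ 1ℤ → A ⊡ adj A ≡ one
    adj-inverseʳ (mat a b c d) eq =
      mat≡ (trans (e₁ a b c d) eq) (e₂ a b) (e₃ c d) (trans (e₄ a b c d) eq)
      where
      e₁ : ∀ a b c d → a * d + b * (- c) ≡ a * d - b * c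
      e₁ = solve-∀
      e₂ : ∀ a b → a * (- b) + b * a ≡ 0ℤ
      e₂ = solve-∀
      e₃ : ∀ c d → c * d + d * (- c) ≡ 0ℤ
      e₃ = solve-∀
      e₄ : ∀ a b c d → c * (- b) + d * a ≡ a * d - b * c
      e₄ = solve-∀

infixl 7 _·_
_·_ : SL₂ℤ → SL₂ℤ → SL₂ℤ
(A , a) · (B , b) = (A ⊡ B) , trans (det-⊡ A B) (cong₂ _*_ a b)

I : SL₂ℤ
I = one , refl

infix 8 _⁻¹
_⁻¹ : SL₂ℤ → SL₂ℤ
(A , a) ⁻¹ = adj A , trans (det-adj A) a

private
  ≈-isEquivalence : IsEquivalence _≈_
  ≈-isEquivalence = record { refl = same refl ; sym = ≈-sym ; trans = ≈-trans }
    where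
    ≈-sym : ∀ {A B} → A ≈ B → B ≈ A
    ≈-sym (same e) = same (sym e)
    ≈-sym (opposite e) = opposite (trans (sym (neg-neg _)) (cong neg (sym e)))
    ≈-trans : ∀ {A B C} → A ≈ B → B ≈ C → A ≈ C
    ≈-trans (same e) (same f) = same (trans e f)
    ≈-trans (same e) (opposite f) = opposite (trans e f)
    ≈-trans (opposite e) (same f) = opposite (trans e (cong neg f))
    ≈-trans (opposite e) (opposite f) = same (trans e (trans (cong neg f) (neg-neg _)))

  ·-cong : ∀ {A A′ B B′} → A ≈ A′ → B ≈ B′ → A · B ≈ A′ · B′
  ·-cong (same e) (same f) = same (cong₂ _⊡_ e f)
  ·-cong {A′ = A′} {B′ = B′} (same e) (opposite f) =
    opposite (trans (cong₂ _⊡_ e f) (neg-⊡ʳ (matrix A′) (matrix B′)))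
  ·-cong {A′ = A′} {B′ = B′} (opposite e) (same f) =
    opposite (trans (cong₂ _⊡_ e f) (neg-⊡ˡ (matrix A′) (matrix B′)))
  ·-cong {A′ = A′} {B′ = B′} (opposite e) (opposite f) =
    same (trans (cong₂ _⊡_ e f)
         (trans (neg-⊡ˡ (matrix A′) (neg (matrix B′)))
         (trans (cong neg (neg-⊡ʳ (matrix A′) (matrix B′))) (neg-neg _))))

  ⁻¹-cong : ∀ {A B} → A ≈ B → A ⁻¹ ≈ B ⁻¹
  ⁻¹-cong         (same e) = same (cong adj e)
  ⁻¹-cong {B = B} (opposite e) = opposite (trans (cong adj e) (neg-adj (matrix B)))

PSL₂ℤ : Group 0ℓ 0ℓ
PSL₂ℤ = record
  { Carrier = SL₂ℤ
  ; _≈_     = _≈_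
  ; _∙_     = _·_
  ; ε       = I
  ; _⁻¹     = _⁻¹
  ; isGroup = record
    { isMonoid = record
      { isSemigroup = record
        { isMagma = record
          { isEquivalence = ≈-isEquivalence
          ; ∙-cong = ·-cong
          }
        ; assoc = λ A B C → same (⊡-assoc (matrix A) (matrix B) (matrix C))
        }
      ; identity = (λ A → same (⊡-identityˡ (matrix A)))
                 , (λ A → same (⊡-identityʳ (matrix A)))
      }
    ; inverse = (λ A → same (adj-inverseˡ (matrix A) (det≡1 A)))
              , (λ A → same (adj-inverseʳ (matrix A) (det≡1 A)))
    ; ⁻¹-cong = ⁻¹-cong
    }
  }

private module P = Group PSL₂ℤ

S R : SL₂ℤ
S = mat 0ℤ (- 1ℤ) 1ℤ 0ℤ , refl
R = mat 1ℤ (- 1ℤ) 1ℤ 0ℤ , refl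

trace : SL₂ℤ → ℤ
trace M = Mat.p (matrix M) + Mat.s (matrix M)

Hyperbolic : SL₂ℤ → Set
Hyperbolic M = 2 ℕ.< ∣ trace M ∣

infixr 8 _^_
_^_ : SL₂ℤ → ℤ → SL₂ℤ
M ^ (+ zero)    = I
M ^ (+ suc n)   = M · M ^ (+ n)
M ^ -[1+ zero ] = M ⁻¹
M ^ -[1+ suc n ] = M ⁻¹ · M ^ -[1+ n ]

------------------------------------------------------------------------
-- Bipartite ribbon graphs

-- A bipartite graph with a cyclic order of the edges at each vertex is
-- given by its edges and two permutations of them: the ⊗-vertices are the
-- orbits of σ, the •-vertices the orbits of ρ, an edge joins the two orbits
-- containing it, and σ, ρ send an edge to the counterclockwise next one at
-- its ⊗-end, •-end.
record RibbonGraph : Set₁ where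
  field
    edges : Setoid 0ℓ 0ℓ
    σ ρ   : Inverse edges edges

  open Setoid edges public renaming (Carrier to Edge; _≈_ to _≈ᵉ_) using ()

data Side : Set where
  inner outer : Side

module _ (G : RibbonGraph) where
  open RibbonGraph G

  -- A path arriving at a trivalent •-vertex along e leaves it along ρ e or
  -- ρ⁻¹ e.  Since ρ is counterclockwise, leaving along ρ e is turning right;
  -- the remaining edge ρ⁻¹ e then lies to the left of the path, which is the
  -- inner side of a spine.  The index is the side of that remaining edge.
  turn : Side → Edge → Edge
  turn inner = Inverse.to ρ
  turn outer = Inverse.from ρ

  -- A directed bi-infinite non-backtracking path in a graph with bivalent
  -- ⊗-vertices and trivalent •-vertices.  It meets its n-th •-vertex along
  -- enter n (traversed from ⊗ to •), leaves it along leave n (traversed from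
  -- • to ⊗), and `branch` is the word of sides on which the branches lie.
  record Line : Set where
    field
      enter leave : ℤ → Edge
      branch      : ℤ → Side
      at-•        : ∀ n → leave n ≈ᵉ turn (branch n) (enter n)
      at-⊗        : ∀ n → enter (ℤ.suc n) ≈ᵉ Inverse.to σ (leave n)

-- A ribbon graph with a directed spine.  The spine is recorded as the set of
-- its edges whose direction is from ⊗ to •; its edges directed from • to ⊗
-- are those which σ sends into this set, the ⊗-vertices being bivalent.
record SpinedGraph : Set₁ where
  field
    graph : RibbonGraph
  open RibbonGraph graph public
  field
    Spine : Edge → Set

-- A reflection of the plane reverses the cyclic order at every vertex.
reflect : RibbonGraph → RibbonGraph
reflect G = record
  { edges = edges
  ; σ     = Symmetry.inverse σ
  ; ρ     = Symmetry.inverse ρ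
  }
  where open RibbonGraph G

-- The reflected spine runs clockwise, so its direction is reversed: the edges
-- now directed from ⊗ to • are those formerly directed from • to ⊗.
infix 8 _ʳ
_ʳ : SpinedGraph → SpinedGraph
C ʳ = record
  { graph = reflect graph
  ; Spine = λ e → Spine (Inverse.to σ e)
  }
  where open SpinedGraph C

-- Under C ↦ C ʳ a path is run through backwards: the word is reversed, and
-- inner and outer are kept.
reflectLine : ∀ {G} → Line G → Line (reflect G)
reflectLine {G} l = record
  { enter  = λ n → leave (- n)
  ; leave  = λ n → enter (- n)
  ; branch = λ n → branch (- n)
  ; at-•   = λ n → E.sym (back (branch (- n)) (at-• (- n)))
  ; at-⊗   = λ n → E.sym (Inverse.inverseʳ σ (E.trans (E.reflexive (cong enter (shift n)))
                                                    (at-⊗ (- ℤ.suc n))))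
  }
  where
  open RibbonGraph G
  open Line l
  module E = Setoid edges
  back : ∀ b {x y} → y ≈ᵉ turn G b x → turn (reflect G) b y ≈ᵉ x
  back inner eq = Inverse.inverseʳ ρ eq
  back outer eq = Inverse.inverseˡ ρ eq
  shift : ∀ n → - n ≡ 1ℤ + - (1ℤ + n)
  shift = solve-∀

infix 4 _≅_
record _≅_ (C D : SpinedGraph) : Set where
  private
    module C = SpinedGraph C
    module D = SpinedGraph D
  field
    bijection : Inverse C.edges D.edges
  open Inverse bijection using (to)
  field
    to-σ     : ∀ e → to (Inverse.to C.σ e) D.≈ᵉ Inverse.to D.σ (to e)
    to-ρ     : ∀ e → to (Inverse.to C.ρ e) D.≈ᵉ Inverse.to D.ρ (to e)
    to-Spine : ∀ e → C.Spine e ⇔ D.Spine (to e)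

------------------------------------------------------------------------
-- The Farey tree and the çarks

private
  -- Right multiplication by g, on any quotient of PSL₂(ℤ) compatible with it.
  rightMul : (_∼_ : SL₂ℤ → SL₂ℤ → Set) (equiv : IsEquivalence _∼_) →
             (∀ {V W} → V ≈ W → V ∼ W) →
             (∀ {V W} g → V ∼ W → (V · g) ∼ (W · g)) →
             SL₂ℤ →
             Inverse (record { isEquivalence = equiv }) (record { isEquivalence = equiv })
  rightMul _∼_ equiv incl congʳ g = record
    { to        = _· g
    ; from      = _· g ⁻¹
    ; to-cong   = congʳ g
    ; from-cong = congʳ (g ⁻¹)
    ; inverse   = (λ {V} {W} e → Q.trans (congʳ g e) (incl (cancel₁ V)))
                , (λ {V} {W} e → Q.trans (congʳ (g ⁻¹) e) (incl (cancel₂ V)))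
    }
    where
    module Q = IsEquivalence equiv
    cancel₁ : ∀ V → V · g ⁻¹ · g ≈ V
    cancel₁ V = P.trans (P.assoc V (g ⁻¹) g)
                        (P.trans (P.∙-congˡ (P.inverseˡ g)) (P.identityʳ V))
    cancel₂ : ∀ V → V · g · g ⁻¹ ≈ V
    cancel₂ V = P.trans (P.assoc V g (g ⁻¹))
                        (P.trans (P.∙-congˡ (P.inverseʳ g)) (P.identityʳ V))

-- The orientation is that of the upper half plane: R fixes e^{iπ/3}, where
-- its derivative is e^{-2iπ/3}, so that W ↦ W R is the clockwise rotation at
-- the vertex {W, WR, WR²} and W ↦ W R² the counterclockwise one.
Farey : RibbonGraph
Farey = record
  { edges = P.setoid
  ; σ     = rightMul _≈_ P.isEquivalence (λ e → e) congʳ S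
  ; ρ     = rightMul _≈_ P.isEquivalence (λ e → e) congʳ (R · R)
  }
  where
  congʳ : ∀ {V W} g → V ≈ W → V · g ≈ W · g
  congʳ g = P.∙-congʳ

private
  module _ (M : SL₂ℤ) where
    open import Relation.Binary.Reasoning.Setoid P.setoid

    M·M⁻¹· : ∀ V → V ≈ M · (M ⁻¹ · V)
    M·M⁻¹· V = begin
      V               ≈⟨ P.identityˡ V ⟨
      I · V           ≈⟨ P.∙-congʳ (P.inverseʳ M) ⟨
      M · M ⁻¹ · V    ≈⟨ P.assoc M (M ⁻¹) V ⟩
      M · (M ⁻¹ · V)  ∎

    M⁻¹·M· : ∀ V → V ≈ M ⁻¹ · (M · V)
    M⁻¹·M· V = begin
      V               ≈⟨ P.identityˡ V ⟨
      I · V           ≈⟨ P.∙-congʳ (P.inverseˡ M) ⟨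
      M ⁻¹ · M · V    ≈⟨ P.assoc (M ⁻¹) M V ⟩
      M ⁻¹ · (M · V)  ∎

    ^-suc : ∀ k → M ^ (ℤ.suc k) ≈ M · M ^ k
    ^-suc (+ n)        = P.refl
    ^-suc -[1+ zero ]  = P.sym (P.inverseʳ M)
    ^-suc -[1+ suc n ] = M·M⁻¹· (M ^ -[1+ n ])

    ^-pred : ∀ k → M ^ (ℤ.pred k) ≈ M ⁻¹ · M ^ k
    ^-pred (+ zero)  = P.sym (P.identityʳ (M ⁻¹))
    ^-pred (+ suc n) = M⁻¹·M· (M ^ (+ n))
    ^-pred -[1+ n ]  = P.refl

    ^-+ : ∀ j k → M ^ (j + k) ≈ M ^ j · M ^ k
    ^-+ (+ zero) k = P.trans (P.reflexive (cong (M ^_) (ℤₚ.+-identityˡ k)))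
                             (P.sym (P.identityˡ (M ^ k)))
    ^-+ (+ suc n) k = begin
      M ^ (+ suc n + k)            ≡⟨ cong (M ^_) (ℤₚ.+-assoc 1ℤ (+ n) k) ⟩
      M ^ (ℤ.suc (+ n + k))        ≈⟨ ^-suc (+ n + k) ⟩
      M · M ^ (+ n + k)            ≈⟨ P.∙-congˡ (^-+ (+ n) k) ⟩
      M · (M ^ (+ n) · M ^ k)      ≈⟨ P.assoc M (M ^ (+ n)) (M ^ k) ⟨
      M · M ^ (+ n) · M ^ k        ∎
    ^-+ -[1+ zero ] k = ^-pred k
    ^-+ -[1+ suc n ] k = begin
      M ^ (-[1+ suc n ] + k)          ≡⟨ cong (M ^_) (ℤₚ.+-assoc (- 1ℤ) -[1+ n ] k) ⟩
      M ^ (ℤ.pred (-[1+ n ] + k))     ≈⟨ ^-pred (-[1+ n ] + k) ⟩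
      M ⁻¹ · M ^ (-[1+ n ] + k)       ≈⟨ P.∙-congˡ (^-+ -[1+ n ] k) ⟩
      M ⁻¹ · (M ^ -[1+ n ] · M ^ k)   ≈⟨ P.assoc (M ⁻¹) (M ^ -[1+ n ]) (M ^ k) ⟨
      M ⁻¹ · M ^ -[1+ n ] · M ^ k     ∎

SameOrbit : SL₂ℤ → SL₂ℤ → SL₂ℤ → Set
SameOrbit M V W = ∃[ k ] M ^ k · V ≈ W

private
  ≈⇒SameOrbit : ∀ M {V W} → V ≈ W → SameOrbit M V W
  ≈⇒SameOrbit M {V} e = 0ℤ , P.trans (P.identityˡ V) e

  SameOrbit-·ʳ : ∀ M {V W} g → SameOrbit M V W → SameOrbit M (V · g) (W · g)
  SameOrbit-·ʳ M {V} g (k , e) = k , P.trans (P.sym (P.assoc (M ^ k) V g)) (P.∙-congʳ e)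

  SameOrbit-isEquivalence : ∀ M → IsEquivalence (SameOrbit M)
  SameOrbit-isEquivalence M = record
    { refl  = ≈⇒SameOrbit M P.refl
    ; sym   = λ {V} {W} (k , e) → - k , (begin
        M ^ (- k) · W              ≈⟨ P.∙-congˡ e ⟨
        M ^ (- k) · (M ^ k · V)    ≈⟨ P.assoc (M ^ (- k)) (M ^ k) V ⟨
        M ^ (- k) · M ^ k · V      ≈⟨ P.∙-congʳ (^-+ M (- k) k) ⟨
        M ^ (- k + k) · V          ≡⟨ cong (λ j → M ^ j · V) (ℤₚ.+-inverseˡ k) ⟩
        I · V                      ≈⟨ P.identityˡ V ⟩
        V                          ∎)
    ; trans = λ {U} {V} {W} (j , d) (k , e) → k + j , (begin
        M ^ (k + j) · U            ≈⟨ P.∙-congʳ (^-+ M k j) ⟩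
        M ^ k · M ^ j · U          ≈⟨ P.assoc (M ^ k) (M ^ j) U ⟩
        M ^ k · (M ^ j · U)        ≈⟨ P.∙-congˡ d ⟩
        M ^ k · V                  ≈⟨ e ⟩
        W                          ∎)
    }
    where open import Relation.Binary.Reasoning.Setoid P.setoid

Quotient : SL₂ℤ → RibbonGraph
Quotient M = record
  { edges = record { isEquivalence = SameOrbit-isEquivalence M }
  ; σ     = act S
  ; ρ     = act (R · R)
  }
  where
  act = rightMul (SameOrbit M) (SameOrbit-isEquivalence M) (≈⇒SameOrbit M) (SameOrbit-·ʳ M)

-- M moves the line l forward along itself by d > 0 •-vertices, that is, l is
-- the axis of M in the Farey tree, directed by the translation direction of M.
IsDirectedAxis : SL₂ℤ → Line Farey → Set
IsDirectedAxis M l = Σ[ d ∈ ℕ ] (0 ℕ.< d × (∀ n → M · enter n ≈ enter (n + + d)))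
  where open Line l

-- ⟨M⟩\F with the image of the directed axis of M as its spine.
çark : (M : SL₂ℤ) → Hyperbolic M → SpinedGraph
çark M _ = record
  { graph = Quotient M
  ; Spine = λ W → Σ[ l ∈ Line Farey ]
                    (IsDirectedAxis M l × (∃[ n ] SameOrbit M (Line.enter l n) W))
  }

AmbiguousÇark : SpinedGraph → Set
AmbiguousÇark C = C ≅ C ʳ

------------------------------------------------------------------------
-- Binary quadratic forms

-- form A B C is A x² + B x y + C y².
record Form : Set where
  constructor form
  field A B C : ℤ

eval : Form → ℤ → ℤ → ℤ
eval (form A B C) x y = A * (x * x) + B * (x * y) + C * (y * y)

infixr 7 _∙_
_∙_ : SL₂ℤ → Form → Form
U ∙ form A B C = form
  (A * (p * p) + B * (p * r) + C * (r * r))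
  (+ 2 * (A * (p * q)) + B * (p * s + q * r) + + 2 * (C * (r * s)))
  (A * (q * q) + B * (q * s) + C * (s * s))
  where open Mat (matrix U)

-- The coefficients above are those of the substitution (U ∙ f)(x,y) = f(U(x,y)ᵗ).
eval-∙ : ∀ U f x y → let open Mat (matrix U) in
         eval (U ∙ f) x y ≡ eval f (p * x + q * y) (r * x + s * y)
eval-∙ (mat p q r s , _) (form A B C) x y = trans
  (regroup (A * (p * p)) (B * (p * r)) (C * (r * r))
           (+ 2 * (A * (p * q))) (B * (p * s + q * r)) (+ 2 * (C * (r * s)))
           (A * (q * q)) (B * (q * s)) (C * (s * s)) (x * x) (x * y) (y * y))
  (cong₂ _+_ (cong₂ _+_ (square A p q x y) (product B p q r s x y)) (square C r s x y))
  where
  regroup : ∀ a₁ b₁ c₁ a₂ b₂ c₂ a₃ b₃ c₃ x y z →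
    (a₁ + b₁ + c₁) * x + (a₂ + b₂ + c₂) * y + (a₃ + b₃ + c₃) * z
      ≡ (a₁ * x + a₂ * y + a₃ * z) + (b₁ * x + b₂ * y + b₃ * z) + (c₁ * x + c₂ * y + c₃ * z)
  regroup = solve-∀
  square : ∀ A p q x y →
    A * (p * p) * (x * x) + + 2 * (A * (p * q)) * (x * y) + A * (q * q) * (y * y)
      ≡ A * ((p * x + q * y) * (p * x + q * y))
  square = solve-∀
  product : ∀ B p q r s x y →
    B * (p * r) * (x * x) + B * (p * s + q * r) * (x * y) + B * (q * s) * (y * y)
      ≡ B * ((p * x + q * y) * (r * x + s * y))
  product = solve-∀

-- g ∈[ f ] : g lies in the class of f.
infix 4 _∈[_]
_∈[_] : Form → Form → Set
g ∈[ f ] = ∃[ U ] U ∙ f ≡ g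

inverse : Form → Form
inverse (form A B C) = form A (- B) C

AmbiguousForm : Form → Set
AmbiguousForm f = inverse f ∈[ f ]

content : SL₂ℤ → ℤ
content M = gcd q (gcd (s - p) r)
  where open Mat (matrix M)

private
  content≢0 : ∀ M → Hyperbolic M → ¬ content M ≡ 0ℤ
  content≢0 (mat p q r s , d) hyp eq = ℕₚ.<⇒≱ hyp (begin
    ∣ p + s ∣          ≤⟨ ℤₚ.∣i+j∣≤∣i∣+∣j∣ p s ⟩
    ∣ p ∣ ℕ.+ ∣ s ∣    ≡⟨ cong₂ ℕ._+_ (ℕₚ.m*n≡1⇒m≡1 ∣ p ∣ ∣ s ∣ ∣p∣*∣s∣≡1)
                                      (ℕₚ.m*n≡1⇒n≡1 ∣ p ∣ ∣ s ∣ ∣p∣*∣s∣≡1) ⟩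
    2                  ∎)
    where
    open ℕₚ.≤-Reasoning
    q≡0 : q ≡ 0ℤ
    q≡0 = gcd[i,j]≡0⇒i≡0 q (gcd (s - p) r) eq
    p*s≡1 : p * s ≡ 1ℤ
    p*s≡1 = trans (sym (ℤₚ.+-identityʳ (p * s))) (subst (λ x → p * s - x * r ≡ 1ℤ) q≡0 d)
    ∣p∣*∣s∣≡1 : ∣ p ∣ ℕ.* ∣ s ∣ ≡ 1
    ∣p∣*∣s∣≡1 = trans (sym (ℤₚ.abs-* p s)) (cong ∣_∣ p*s≡1)

-- The sign makes f_M the same for M and -M.
form-of : (M : SL₂ℤ) → Hyperbolic M → Form
form-of M hyp = form (sgn * (r / g)) (sgn * ((s - p) / g)) (sgn * (- q / g))
  where
  open Mat (matrix M)
  g = content M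
  sgn = sign (trace M) ◃ 1
  instance
    g≢0 : NonZero g
    g≢0 = ≢-nonZero (content≢0 M hyp)

{-# OPTIONS --safe #-}

-- An edge W lies on the directed axis of M exactly when W⁻¹ M W is, up to
-- sign, a product of the matrices (1 1; 0 1) and (1 0; 1 1); the factors spell
-- the cyclic word of the çark.  Let θ be conjugation by diag (1 , -1).  Then
-- A ↦ θ(A)⁻¹ fixes both matrices and reverses products, so it reverses words.
-- An isomorphism of the çark of M with its mirror image, corrected by S, turns
-- right multiplication by a word into right multiplication by its image under
-- θ.  It therefore yields V with M^k V = V θ(W⁻¹ M W); traces force k = ±1, and
-- the direction of the spine excludes k = 1.  So the çark is ambiguous if and
-- only if M is conjugate to θ(M)⁻¹.  On forms A ↦ θ(A)⁻¹ is (A,B,C) ↦ (A,-B,C),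
-- and a form with a given trace determines the matrix, so the same condition
-- expresses that f_M is equivalent to its inverse.
module Submission where

open import Algebra.Bundles using (Group)
import Algebra.Properties.Group as GroupProperties
open import Data.Empty using (⊥-elim)
open import Data.Integer.Base as ℤ
  using (ℤ; +_; -[1+_]; _+_; _*_; _-_; -_; ∣_∣; 0ℤ; 1ℤ; sign; _◃_; NonZero; ≢-nonZero)
import Data.Integer.Divisibility as Unsigned
open import Data.Integer.Divisibility.Signed using (∣ᵤ⇒∣; divides)
open import Data.Integer.DivMod using (_/_; _%_; n%d<d; a≡a%n+[a/n]*n)
open import Data.Integer.GCD using (gcd; gcd[i,j]≡0⇒i≡0; gcd[i,j]∣i; gcd[i,j]∣j)
import Data.Integer.Properties as ℤₚ
open import Data.Integer.Tactic.RingSolver using (solve-∀)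
open import Data.List.Base using (List; []; _∷_; _++_; [_]; _∷ʳ_; reverse; length)
import Data.List.Properties as Listₚ
open import Data.Nat.Base as ℕ using (ℕ; zero; suc)
import Data.Nat.Divisibility as ℕ-Div
open import Data.Nat.Induction using (<-wellFounded)
import Data.Nat.Properties as ℕₚ
import Data.Nat.Tactic.RingSolver as ℕ-Solver
open import Data.Product.Base using (_×_; _,_; ∃-syntax; proj₂)
import Data.Sign.Base as Sign
open import Data.Sum.Base using (_⊎_; inj₁; inj₂)
open import Data.Vec.Base as Vec using (Vec)
import Data.Vec.Properties as Vecₚ
open import Function.Bundles using (_⇔_; mk⇔; Inverse; Equivalence)
open import Induction.WellFounded using (Acc; acc)
open import Relation.Binary.Bundles using (Setoid)
open import Relation.Binary.PropositionalEquality
  using (_≡_; refl; sym; trans; cong; cong₂; subst; module ≡-Reasoning)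
import Relation.Binary.Reasoning.Setoid as SetoidReasoning
open import Relation.Binary.Structures using (IsEquivalence)
open import Relation.Nullary using (¬_; yes; no)
open import Defs

-- Conjugation in a group

module Conjugation {c ℓ} (G : Group c ℓ) where
  open Group G
    using (Carrier; setoid; assoc; ∙-congˡ; ∙-congʳ)
    renaming (sym to ≈-sym; trans to ≈-trans; _≈_ to _≋_; _∙_ to _•_; _⁻¹ to inv)
  open GroupProperties G
  open SetoidReasoning setoid

  private variable m n u v x y : Carrier

  -- Conjugacy is kept as an equation `m • v ≋ v • x` with its conjugator `v`, so that conjugations
  -- compose and invert by regrouping. The left factor of the composite conjugator belongs to the
  -- first step.
  conj-trans : m • v ≋ v • x → x • u ≋ u • y → m • (v • u) ≋ (v • u) • y
  conj-trans {m} {v} {x} {u} {y} e f = begin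
    m • (v • u)  ≈⟨ assoc m v u ⟨
    m • v • u    ≈⟨ ∙-congʳ e ⟩
    v • x • u    ≈⟨ assoc v x u ⟩
    v • (x • u)  ≈⟨ ∙-congˡ f ⟩
    v • (u • y)  ≈⟨ assoc v u y ⟨
    v • u • y    ∎

  conj-inv : m • v ≋ v • x → inv m • v ≋ v • inv x
  conj-inv {m} {v} {x} e = begin
    inv m • v                    ≈⟨ //-rightDividesʳ x (inv m • v) ⟨
    inv m • v • x • inv x        ≈⟨ ∙-congʳ (assoc (inv m) v x) ⟩
    inv m • (v • x) • inv x      ≈⟨ ∙-congʳ (∙-congˡ e) ⟨
    inv m • (m • v) • inv x      ≈⟨ ∙-congʳ (\\-leftDividesʳ m v) ⟩
    v • inv x                    ∎

  conj-sym : m • v ≋ v • x → x • inv v ≋ inv v • m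
  conj-sym {m} {v} {x} e = begin
    x • inv v                    ≈⟨ \\-leftDividesʳ v (x • inv v) ⟨
    inv v • (v • (x • inv v))    ≈⟨ ∙-congˡ (assoc v x (inv v)) ⟨
    inv v • (v • x • inv v)      ≈⟨ ∙-congˡ (∙-congʳ e) ⟨
    inv v • (m • v • inv v)      ≈⟨ ∙-congˡ (//-rightDividesʳ v m) ⟩
    inv v • m                    ∎

  conj-by : ∀ m v → m • v ≋ v • (inv v • m • v)
  conj-by m v = begin
    m • v                  ≈⟨ \\-leftDividesˡ v (m • v) ⟨
    v • (inv v • (m • v))  ≈⟨ ∙-congˡ (assoc (inv v) m v) ⟨
    v • (inv v • m • v)    ∎

  conj-unique : m • v ≋ v • x → m • v ≋ v • y → x ≋ y
  conj-unique {m} {v} {x} {y} e f = begin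
    x                ≈⟨ \\-leftDividesʳ v x ⟨
    inv v • (v • x)  ≈⟨ ∙-congˡ (≈-trans (≈-sym e) f) ⟩
    inv v • (v • y)  ≈⟨ \\-leftDividesʳ v y ⟩
    y                ∎

private module P = Group PSL₂ℤ
open GroupProperties PSL₂ℤ
open Conjugation PSL₂ℤ

-- Words and the involution θ

mat≡ : ∀ {p q r s p′ q′ r′ s′} → p ≡ p′ → q ≡ q′ → r ≡ r′ → s ≡ s′ →
       mat p q r s ≡ mat p′ q′ r′ s′
mat≡ refl refl refl refl = refl

-- Conjugation by diag (1 , -1).
flip : Mat → Mat
flip (mat p q r s) = mat p (- q) (- r) s

flip-⊡ : ∀ A B → flip (A ⊡ B) ≡ flip A ⊡ flip B
flip-⊡ (mat a b c d) (mat e f g h) =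
  mat≡ (diagˡ a b e g) (offˡ a b f h) (offʳ c d e g) (diagʳ c d f h)
  where
  diagˡ : ∀ a b e g → a * e + b * g ≡ a * e + (- b) * (- g)
  diagˡ = solve-∀
  offˡ : ∀ a b f h → - (a * f + b * h) ≡ a * (- f) + (- b) * h
  offˡ = solve-∀
  offʳ : ∀ c d e g → - (c * e + d * g) ≡ (- c) * e + d * (- g)
  offʳ = solve-∀
  diagʳ : ∀ c d f h → c * f + d * h ≡ (- c) * (- f) + d * h
  diagʳ = solve-∀

flip-flip : ∀ A → flip (flip A) ≡ A
flip-flip (mat p q r s) = mat≡ refl (ℤₚ.neg-involutive q) (ℤₚ.neg-involutive r) refl

det-flip : ∀ A → det (flip A) ≡ det A
det-flip (mat p q r s) = eq p q r s
  where
  eq : ∀ p q r s → p * s - (- q) * (- r) ≡ p * s - q * r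
  eq = solve-∀

-- On the upper half plane this is conjugation by the reflection z ↦ -z̄, so it comes from an
-- orientation-reversing symmetry.
θ : SL₂ℤ → SL₂ℤ
θ (A , a) = flip A , trans (det-flip A) a

θ-cong : ∀ {A B} → A ≈ B → θ A ≈ θ B
θ-cong (same e)     = same (cong flip e)
θ-cong (opposite e) = opposite (cong flip e)

θ-· : ∀ A B → θ (A · B) ≈ θ A · θ B
θ-· A B = same (flip-⊡ (matrix A) (matrix B))

θ-θ : ∀ A → θ (θ A) ≈ A
θ-θ A = same (flip-flip (matrix A))

θ-⁻¹ : ∀ A → θ (A ⁻¹) ≈ θ A ⁻¹
θ-⁻¹ A = same refl

θ-conj : ∀ {M V X} → M · V ≈ V · X → θ M · θ V ≈ θ V · θ X
θ-conj {M} {V} {X} e = begin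
  θ M · θ V  ≈⟨ θ-· M V ⟨
  θ (M · V)  ≈⟨ θ-cong e ⟩
  θ (V · X)  ≈⟨ θ-· V X ⟩
  θ V · θ X  ∎
  where open SetoidReasoning P.setoid

turning : Side → SL₂ℤ
turning inner = R · R
turning outer = (R · R) ⁻¹

-- Up to sign, letter inner is (1 0; 1 1) and letter outer is (1 1; 0 1).
letter : Side → SL₂ℤ
letter b = turning b · S

⟪_⟫ : List Side → SL₂ℤ
⟪ [] ⟫    = I
⟪ b ∷ w ⟫ = letter b · ⟪ w ⟫

⟪⟫-++ : ∀ u w → ⟪ u ++ w ⟫ ≈ ⟪ u ⟫ · ⟪ w ⟫
⟪⟫-++ []      w = P.sym (P.identityˡ ⟪ w ⟫)
⟪⟫-++ (b ∷ u) w = P.trans (P.∙-congˡ (⟪⟫-++ u w)) (P.sym (P.assoc (letter b) ⟪ u ⟫ ⟪ w ⟫))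

-- A unipotent triangular matrix is inverted by negating its off-diagonal entry, which is what `θ`
-- does.
θ-letter : ∀ b → θ (letter b) ≈ letter b ⁻¹
θ-letter inner = same refl
θ-letter outer = same refl

⟪⟫-∷ʳ : ∀ w b → ⟪ w ∷ʳ b ⟫ ≈ ⟪ w ⟫ · letter b
⟪⟫-∷ʳ w b = P.trans (⟪⟫-++ w [ b ]) (P.∙-congˡ {⟪ w ⟫} (P.identityʳ (letter b)))

-- `θ` keeps the order of the factors and inverts each of them, whereas inversion also reverses the
-- order; the difference is a reversal of the word.
θ-⟪⟫ : ∀ w → θ ⟪ w ⟫ ≈ ⟪ reverse w ⟫ ⁻¹
θ-⟪⟫ []      = same refl
θ-⟪⟫ (b ∷ w) = begin
  θ (letter b · ⟪ w ⟫)              ≈⟨ θ-· (letter b) ⟪ w ⟫ ⟩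
  θ (letter b) · θ ⟪ w ⟫            ≈⟨ P.∙-cong (θ-letter b) (θ-⟪⟫ w) ⟩
  letter b ⁻¹ · ⟪ reverse w ⟫ ⁻¹    ≈⟨ ⁻¹-anti-homo-∙ ⟪ reverse w ⟫ (letter b) ⟨
  (⟪ reverse w ⟫ · letter b) ⁻¹     ≈⟨ P.⁻¹-cong (⟪⟫-∷ʳ (reverse w) b) ⟨
  ⟪ reverse w ∷ʳ b ⟫ ⁻¹             ≡⟨ cong (λ u → ⟪ u ⟫ ⁻¹) (Listₚ.unfold-reverse b w) ⟨
  ⟪ reverse (b ∷ w) ⟫ ⁻¹            ∎
  where open SetoidReasoning P.setoid

θ-⟪⟫⁻¹ : ∀ w → θ ⟪ w ⟫ ⁻¹ ≈ ⟪ reverse w ⟫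
θ-⟪⟫⁻¹ w = P.trans (P.⁻¹-cong (θ-⟪⟫ w)) (⁻¹-involutive ⟪ reverse w ⟫)

-- Traces

-- The trace is defined only up to sign on PSL₂(ℤ).
∣trace∣ : SL₂ℤ → ℕ
∣trace∣ M = ∣ trace M ∣

trace-neg : ∀ {A B} → matrix A ≡ neg (matrix B) → trace A ≡ - trace B
trace-neg {B = mat p q r s , _} refl = sym (ℤₚ.neg-distrib-+ p s)

∣trace∣-cong : ∀ {A B} → A ≈ B → ∣trace∣ A ≡ ∣trace∣ B
∣trace∣-cong (same e) = cong (λ A → ∣ Mat.p A + Mat.s A ∣) e
∣trace∣-cong {A} {B} (opposite e) = trans (cong ∣_∣ (trace-neg {A} {B} e)) (ℤₚ.∣-i∣≡∣i∣ (trace B))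

trace-comm : ∀ A B → trace (A · B) ≡ trace (B · A)
trace-comm (mat a b c d , _) (mat e f g h , _) = eq a b c d e f g h
  where
  eq : ∀ a b c d e f g h → a * e + b * g + (c * f + d * h) ≡ e * a + f * c + (g * b + h * d)
  eq = solve-∀

trace-⁻¹ : ∀ A → trace (A ⁻¹) ≡ trace A
trace-⁻¹ (mat p q r s , _) = ℤₚ.+-comm s p

∣trace∣-conj : ∀ {M V X} → M · V ≈ V · X → ∣trace∣ M ≡ ∣trace∣ X
∣trace∣-conj {M} {V} {X} e = begin
  ∣trace∣ M               ≡⟨ ∣trace∣-cong (//-rightDividesʳ V M) ⟨
  ∣trace∣ (M · V · V ⁻¹)  ≡⟨ cong ∣_∣ (trace-comm (M · V) (V ⁻¹)) ⟩
  ∣trace∣ (V ⁻¹ · (M · V)) ≡⟨ ∣trace∣-cong (P.∙-congˡ {V ⁻¹} e) ⟩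
  ∣trace∣ (V ⁻¹ · (V · X)) ≡⟨ ∣trace∣-cong (\\-leftDividesʳ V X) ⟩
  ∣trace∣ X               ∎
  where open ≡-Reasoning

-- The Cayley-Hamilton identity for a matrix of determinant 1, multiplied by `X`.
trace-recurrence : ∀ M X → trace (M · (M · X)) ≡ trace M * trace (M · X) - trace X
trace-recurrence (mat p q r s , d) (mat a b c e , _) = begin
  _ ≡⟨ eq p q r s a b c e ⟩
  (p + s) * (p * a + q * c + (r * b + s * e)) - (p * s - q * r) * (a + e)
    ≡⟨ cong (λ x → (p + s) * (p * a + q * c + (r * b + s * e)) - x * (a + e)) d ⟩
  (p + s) * (p * a + q * c + (r * b + s * e)) - 1ℤ * (a + e)
    ≡⟨ cong (λ x → (p + s) * (p * a + q * c + (r * b + s * e)) - x) (ℤₚ.*-identityˡ (a + e)) ⟩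
  _ ∎
  where
  open ≡-Reasoning
  eq : ∀ p q r s a b c e →
    p * (p * a + q * c) + q * (r * a + s * c) + (r * (p * b + q * e) + s * (r * b + s * e))
    ≡ (p + s) * (p * a + q * c + (r * b + s * e)) - (p * s - q * r) * (a + e)
  eq = solve-∀

-- From `z + x = t * y` follows ∣z∣ + ∣x∣ ≥ 3∣y∣, and ∣x∣ is less than ∣y∣.
recurrence-grows : ∀ t x y z → 2 ℕ.< ∣ t ∣ → z ≡ t * y - x → ∣ x ∣ ℕ.< ∣ y ∣ → ∣ y ∣ ℕ.< ∣ z ∣
recurrence-grows t x y z t>2 eq x<y = ℕₚ.+-cancelʳ-< (∣ x ∣) (∣ y ∣) (∣ z ∣) (begin-strict
  ∣ y ∣ ℕ.+ ∣ x ∣  <⟨ ℕₚ.+-monoʳ-< ∣ y ∣ x<y ⟩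
  ∣ y ∣ ℕ.+ ∣ y ∣  ≤⟨ ℕₚ.+-monoʳ-≤ ∣ y ∣ (ℕₚ.m≤m+n ∣ y ∣ _) ⟩
  3 ℕ.* ∣ y ∣      ≤⟨ ℕₚ.*-monoˡ-≤ ∣ y ∣ t>2 ⟩
  ∣ t ∣ ℕ.* ∣ y ∣  ≡⟨ ℤₚ.abs-* t y ⟨
  ∣ t * y ∣        ≡⟨ cong ∣_∣ (trans (regroup (t * y) x) (cong (_+ x) (sym eq))) ⟩
  ∣ z + x ∣        ≤⟨ ℤₚ.∣i+j∣≤∣i∣+∣j∣ z x ⟩
  ∣ z ∣ ℕ.+ ∣ x ∣  ∎)
  where
  open ℕₚ.≤-Reasoning
  regroup : ∀ u x → u ≡ u - x + x
  regroup = solve-∀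

∣trace-^∣-grows : ∀ M → Hyperbolic M → ∀ n →
  ∣trace∣ (M ^ (+ n)) ℕ.< ∣trace∣ (M ^ (+ suc n))
-- The identity has trace 2, so hyperbolicity is the base case.
∣trace-^∣-grows M hyp zero = subst (2 ℕ.<_) (sym (∣trace∣-cong (P.identityʳ M))) hyp
∣trace-^∣-grows M hyp (suc n) =
  recurrence-grows (trace M) (trace (M ^ (+ n))) (trace (M ^ (+ suc n))) (trace (M ^ (+ suc (suc n))))
    hyp (trace-recurrence M (M ^ (+ n))) (∣trace-^∣-grows M hyp n)

∣trace-^∣≡⇒≡1 : ∀ M → Hyperbolic M → ∀ n → ∣trace∣ (M ^ (+ n)) ≡ ∣trace∣ M → n ≡ 1
∣trace-^∣≡⇒≡1 M hyp n eq = go n (trans eq (sym (∣trace∣-cong (P.identityʳ M))))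
  where
  t : ℕ → ℕ
  t n = ∣trace∣ (M ^ (+ n))
  above : ∀ n → t 1 ℕ.< t (suc (suc n))
  above zero    = ∣trace-^∣-grows M hyp 1
  above (suc n) = ℕₚ.<-trans (above n) (∣trace-^∣-grows M hyp (suc (suc n)))
  go : ∀ n → t n ≡ t 1 → n ≡ 1
  go zero          e = ⊥-elim (ℕₚ.<⇒≢ (∣trace-^∣-grows M hyp 0) e)
  go (suc zero)    e = refl
  go (suc (suc n)) e = ⊥-elim (ℕₚ.<⇒≢ (above n) (sym e))

^-negsuc : ∀ M n → M ^ -[1+ n ] ≈ (M ⁻¹) ^ (+ suc n)
^-negsuc M zero    = P.sym (P.identityʳ (M ⁻¹))
^-negsuc M (suc n) = P.∙-congˡ {M ⁻¹} (^-negsuc M n)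

Hyperbolic-⁻¹ : ∀ M → Hyperbolic M → Hyperbolic (M ⁻¹)
Hyperbolic-⁻¹ M = subst (λ t → 2 ℕ.< ∣ t ∣) (sym (trace-⁻¹ M))

-- Strict growth along the positive powers leaves only the exponent 1; negative powers are positive
-- powers of the inverse, which has the same trace.
∣trace-^∣≡⇒±1 : ∀ M → Hyperbolic M → ∀ k → ∣trace∣ (M ^ k) ≡ ∣trace∣ M → k ≡ 1ℤ ⊎ k ≡ - 1ℤ
∣trace-^∣≡⇒±1 M hyp (+ n)    eq = inj₁ (cong +_ (∣trace-^∣≡⇒≡1 M hyp n eq))
∣trace-^∣≡⇒±1 M hyp -[1+ n ] eq =
  inj₂ (cong -[1+_] (ℕₚ.suc-injective
    (∣trace-^∣≡⇒≡1 (M ⁻¹) (Hyperbolic-⁻¹ M hyp) (suc n)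
      (trans (sym (∣trace∣-cong (^-negsuc M n)))
             (trans eq (cong ∣_∣ (sym (trace-⁻¹ M))))))))

-- The product of the row sums is blind to the sign, and it grows with each
-- letter of a word.
rowProduct : SL₂ℤ → ℤ
rowProduct A = (p + q) * (r + s)
  where open Mat (matrix A)

rowProduct-cong : ∀ {A B} → A ≈ B → rowProduct A ≡ rowProduct B
rowProduct-cong (same e) = cong (λ A → (Mat.p A + Mat.q A) * (Mat.r A + Mat.s A)) e
rowProduct-cong {B = mat p q r s , _} (opposite refl) = eq p q r s
  where
  eq : ∀ p q r s → (- p + - q) * (- r + - s) ≡ (p + q) * (r + s)
  eq = solve-∀

-- A positive product has `y` nonzero, hence y² ≥ 1. Prefixing a letter to a word changes
-- `rowProduct` in exactly this way, with `x` and `y` the two row sums.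
product-grows : ∀ x y n → x * y ≡ + suc n → ∃[ m ] x * y + y * y ≡ + suc (suc m)
product-grows x y n eq with y * y in sq
... | -[1+ _ ] = ⊥-elim (noneg y sq)
  where
  noneg : ∀ y {m} → ¬ y * y ≡ -[1+ m ]
  noneg (+ zero)  ()
  noneg (+ suc n) ()
  noneg -[1+ n ]  ()
... | + suc m  = m ℕ.+ n , trans (cong (_+ + suc m) eq) (cong +_ (trans (ℕₚ.+-comm (suc n) (suc m)) (cong suc (ℕₚ.+-suc m n))))
... | + zero   = ⊥-elim (absurd (trans (sym eq) (trans (cong (x *_) (y≡0 y sq)) (ℤₚ.*-zeroʳ x))))
  where
  absurd : ¬ + suc n ≡ 0ℤ
  absurd ()
  y≡0 : ∀ y → y * y ≡ 0ℤ → y ≡ 0ℤ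
  y≡0 (+ zero) _ = refl

rowProduct-⟪⟫ : ∀ w → ∃[ n ] rowProduct ⟪ w ⟫ ≡ + suc n
rowProduct-∷ : ∀ b w → ∃[ n ] rowProduct ⟪ b ∷ w ⟫ ≡ + suc (suc n)

rowProduct-⟪⟫ []      = 0 , refl
rowProduct-⟪⟫ (b ∷ w) = let n , eq = rowProduct-∷ b w in suc n , eq

rowProduct-∷ outer w =
  let n , eq = rowProduct-⟪⟫ w
      m , eq′ = product-grows (p + q) (r + s) n eq
  in m , trans (ident p q r s) eq′
  where
  open Mat (matrix ⟪ w ⟫)
  ident : ∀ p q r s → (1ℤ * p + 1ℤ * r + (1ℤ * q + 1ℤ * s)) * (0ℤ * p + 1ℤ * r + (0ℤ * q + 1ℤ * s))
        ≡ (p + q) * (r + s) + (r + s) * (r + s)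
  ident = solve-∀
rowProduct-∷ inner w =
  let n , eq = rowProduct-⟪⟫ w
      m , eq′ = product-grows (r + s) (p + q) n (trans (ℤₚ.*-comm (r + s) (p + q)) eq)
  in m , trans (ident p q r s) eq′
  where
  open Mat (matrix ⟪ w ⟫)
  ident : ∀ p q r s → (- 1ℤ * p + 0ℤ * r + (- 1ℤ * q + 0ℤ * s)) * (- 1ℤ * p + - 1ℤ * r + (- 1ℤ * q + - 1ℤ * s))
        ≡ (r + s) * (p + q) + (p + q) * (p + q)
  ident = solve-∀

-- The identity has row product 1, while a word with at least one letter has row product at least 2.
⟪⟫≈I⇒[] : ∀ w → ⟪ w ⟫ ≈ I → w ≡ []
⟪⟫≈I⇒[] []      _ = refl
⟪⟫≈I⇒[] (b ∷ w) e with rowProduct-∷ b w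
... | _ , eq with trans (sym eq) (rowProduct-cong e)
... | ()

-- Nonnegative matrices are words

ℕmat : (a b c d : ℕ) → Mat
ℕmat a b c d = mat (+ a) (+ b) (+ c) (+ d)

ℕdet : ∀ a b c d → a ℕ.* d ≡ suc (b ℕ.* c) → det (ℕmat a b c d) ≡ 1ℤ
ℕdet a b c d eq = begin
  + a * + d - + b * + c      ≡⟨ cong₂ _-_ (sym (ℤₚ.pos-* a d)) (sym (ℤₚ.pos-* b c)) ⟩
  + (a ℕ.* d) - + (b ℕ.* c)  ≡⟨ cong (λ x → + x - + (b ℕ.* c)) eq ⟩
  1ℤ + + (b ℕ.* c) - + (b ℕ.* c)  ≡⟨ ℤₚ.+-assoc 1ℤ (+ (b ℕ.* c)) (- + (b ℕ.* c)) ⟩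
  1ℤ + (+ (b ℕ.* c) - + (b ℕ.* c))  ≡⟨ cong (λ x → 1ℤ + x) (ℤₚ.+-inverseʳ (+ (b ℕ.* c))) ⟩
  1ℤ                         ∎
  where open ≡-Reasoning

-- The Euclidean algorithm on the rows.
ℕmat-word : ∀ a b c d → a ℕ.* d ≡ suc (b ℕ.* c) → ∀ A → matrix A ≡ ℕmat a b c d → ∃[ w ] A ≈ ⟪ w ⟫
ℕmat-word a b c d det A eqA = go a b c d (<-wellFounded _) det A eqA
  where
  shrinks : ∀ {m n} k → n ≡ m ℕ.+ suc k → m ℕ.< n
  shrinks {m} k refl = ℕₚ.m<m+n m ℕ.z<s

  row₁ : ∀ o o′ c d′ → let d = suc d′ in c ℕ.+ o ℕ.+ (d ℕ.+ o′) ℕ.+ c ℕ.+ d ≡ o ℕ.+ o′ ℕ.+ c ℕ.+ d ℕ.+ suc (c ℕ.+ d′)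
  row₁ = ℕ-Solver.solve-∀
  row₂ : ∀ a′ b o o′ → let a = suc a′ in a ℕ.+ b ℕ.+ (a ℕ.+ o) ℕ.+ (b ℕ.+ o′) ≡ a ℕ.+ b ℕ.+ o ℕ.+ o′ ℕ.+ suc (a′ ℕ.+ b)
  row₂ = ℕ-Solver.solve-∀

  det₁ : ∀ o o′ c d → (c ℕ.+ o) ℕ.* d ≡ suc ((d ℕ.+ o′) ℕ.* c) → o ℕ.* d ≡ suc (o′ ℕ.* c)
  det₁ o o′ c d eq = ℕₚ.+-cancelˡ-≡ (c ℕ.* d) _ _
    (trans (lhs o c d) (trans eq (rhs o′ c d)))
    where
    lhs : ∀ o c d → c ℕ.* d ℕ.+ o ℕ.* d ≡ (c ℕ.+ o) ℕ.* d
    lhs = ℕ-Solver.solve-∀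
    rhs : ∀ o′ c d → suc ((d ℕ.+ o′) ℕ.* c) ≡ c ℕ.* d ℕ.+ suc (o′ ℕ.* c)
    rhs = ℕ-Solver.solve-∀
  det₂ : ∀ a b o o′ → a ℕ.* (b ℕ.+ o′) ≡ suc (b ℕ.* (a ℕ.+ o)) → a ℕ.* o′ ≡ suc (b ℕ.* o)
  det₂ a b o o′ eq = ℕₚ.+-cancelˡ-≡ (a ℕ.* b) _ _
    (trans (lhs a b o′) (trans eq (rhs a b o)))
    where
    lhs : ∀ a b o′ → a ℕ.* b ℕ.+ a ℕ.* o′ ≡ a ℕ.* (b ℕ.+ o′)
    lhs = ℕ-Solver.solve-∀
    rhs : ∀ a b o → suc (b ℕ.* (a ℕ.+ o)) ≡ a ℕ.* b ℕ.+ suc (b ℕ.* o)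
    rhs = ℕ-Solver.solve-∀

  entry₁ : ∀ x y → + (x ℕ.+ y) ≡ 1ℤ * + y + 1ℤ * + x
  entry₁ x y = trans (ℤₚ.pos-+ x y) (eq (+ x) (+ y))
    where
    eq : ∀ x y → x + y ≡ 1ℤ * y + 1ℤ * x
    eq = solve-∀
  entry₂ : ∀ x y → x ≡ 0ℤ * y + 1ℤ * x
  entry₂ = solve-∀
  entry₃ : ∀ x y → x ≡ - (- 1ℤ * x + 0ℤ * y)
  entry₃ = solve-∀
  entry₄ : ∀ x y → + (x ℕ.+ y) ≡ - (- 1ℤ * + x + - 1ℤ * + y)
  entry₄ x y = trans (ℤₚ.pos-+ x y) (eq (+ x) (+ y))
    where
    eq : ∀ x y → x + y ≡ - (- 1ℤ * x + - 1ℤ * y)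
    eq = solve-∀

  go : ∀ a b c d → Acc ℕ._<_ (a ℕ.+ b ℕ.+ c ℕ.+ d) → a ℕ.* d ≡ suc (b ℕ.* c) →
       ∀ A → matrix A ≡ ℕmat a b c d → ∃[ w ] A ≈ ⟪ w ⟫
  -- The first row dominates the second: their difference (`o`, `o′`) replaces it and an `outer` is
  -- split off on the left. In `subtract₂` the roles of the rows are exchanged and an `inner` is
  -- split off.
  subtract₁ : ∀ a b c d o o′ → c ℕ.+ o ≡ a → d ℕ.+ o′ ≡ b → Acc ℕ._<_ (a ℕ.+ b ℕ.+ c ℕ.+ d) →
    a ℕ.* d ≡ suc (b ℕ.* c) → ∀ A → matrix A ≡ ℕmat a b c d → ∃[ w ] A ≈ ⟪ w ⟫
  subtract₂ : ∀ a b c d o o′ → a ℕ.+ o ≡ c → b ℕ.+ o′ ≡ d → Acc ℕ._<_ (a ℕ.+ b ℕ.+ c ℕ.+ d) →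
    a ℕ.* d ≡ suc (b ℕ.* c) → ∀ A → matrix A ≡ ℕmat a b c d → ∃[ w ] A ≈ ⟪ w ⟫

  -- The determinant excludes `d = 0`, so the subtracted row is nonzero and the sum of the entries
  -- drops.
  subtract₁ _ _ c zero o o′ refl refl _ eq with () ← trans (sym (ℕₚ.*-zeroʳ (c ℕ.+ o))) eq
  subtract₁ _ _ c (suc d) o o′ refl refl (acc rec) eq A eqA =
    let B = ℕmat o o′ c (suc d) , ℕdet o o′ c (suc d) eq′
        w , e = go o o′ c (suc d) (rec (shrinks (c ℕ.+ d) (row₁ o o′ c d))) eq′ B refl
    in outer ∷ w
     , P.trans (same (trans eqA (mat≡ (entry₁ c o) (entry₁ (suc d) o′) (entry₂ (+ c) (+ o)) (entry₂ (+ suc d) (+ o′)))))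
               (P.∙-congˡ {letter outer} e)
    where eq′ = det₁ o o′ c (suc d) eq

  subtract₂ (suc a) b _ _ o o′ refl refl (acc rec) eq A eqA =
    let B = ℕmat (suc a) b o o′ , ℕdet (suc a) b o o′ eq′
        w , e = go (suc a) b o o′ (rec (shrinks (a ℕ.+ b) (row₂ a b o o′))) eq′ B refl
    in inner ∷ w
     , P.trans (opposite (trans eqA (mat≡ (entry₃ (+ suc a) (+ o)) (entry₃ (+ b) (+ o′)) (entry₄ (suc a) o) (entry₄ b o′))))
               (P.∙-congˡ {letter inner} e)
    where eq′ = det₂ (suc a) b o o′ eq

  go a b c d ac eq A eqA with a ℕₚ.≤? c | b ℕₚ.≤? d
  ... | yes a≤c | yes b≤d =
    subtract₂ a b c d _ _ (ℕₚ.m+[n∸m]≡n a≤c) (ℕₚ.m+[n∸m]≡n b≤d) ac eq A eqA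
  ... | no a≰c | no b≰d =
    subtract₁ a b c d _ _ (ℕₚ.m+[n∸m]≡n (ℕₚ.≰⇒≥ a≰c)) (ℕₚ.m+[n∸m]≡n (ℕₚ.≰⇒≥ b≰d)) ac eq A eqA
  -- Here a d ≤ b c, against a d = b c + 1.
  ... | yes a≤c | no b≰d =
    ⊥-elim (ℕₚ.<⇒≱ (ℕₚ.≤-reflexive (sym eq)) (ℕₚ.≤-trans (ℕₚ.*-mono-≤ a≤c (ℕₚ.≰⇒≥ b≰d)) (ℕₚ.≤-reflexive (ℕₚ.*-comm c b))))
  ... | no a≰c | yes b≤d with ℕₚ.m≤n⇒m<n∨m≡n b≤d
  ...   | inj₂ b≡d =
    subtract₁ a b c d _ 0 (ℕₚ.m+[n∸m]≡n (ℕₚ.≰⇒≥ a≰c)) (trans (ℕₚ.+-identityʳ d) (sym b≡d)) ac eq A eqA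
  -- Neither row dominates, so a d ≥ (c + 1)(b + 1). Comparison with a d = b c + 1 leaves b + c = 0,
  -- and the matrix is the identity.
  ...   | inj₁ b<d = [] , same (trans eqA identity)
    where
    small : suc (b ℕ.+ c) ℕ.+ c ℕ.* b ℕ.≤ 1 ℕ.+ c ℕ.* b
    small = begin
      suc (b ℕ.+ c) ℕ.+ c ℕ.* b  ≡⟨ expand b c ⟩
      suc c ℕ.* suc b            ≤⟨ ℕₚ.*-mono-≤ (ℕₚ.≰⇒> a≰c) b<d ⟩
      a ℕ.* d                    ≡⟨ eq ⟩
      suc (b ℕ.* c)              ≡⟨ cong suc (ℕₚ.*-comm b c) ⟩
      suc (c ℕ.* b)              ∎
      where
      open ℕₚ.≤-Reasoning
      expand : ∀ b c → suc (b ℕ.+ c) ℕ.+ c ℕ.* b ≡ suc c ℕ.* suc b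
      expand = ℕ-Solver.solve-∀
    b+c≡0 : b ℕ.+ c ≡ 0
    b+c≡0 = ℕₚ.n≤0⇒n≡0 (ℕ.s≤s⁻¹ (ℕₚ.+-cancelʳ-≤ (c ℕ.* b) _ _ small))
    b≡0 = ℕₚ.m+n≡0⇒m≡0 b b+c≡0
    c≡0 = ℕₚ.m+n≡0⇒n≡0 b b+c≡0
    ad≡1 : a ℕ.* d ≡ 1
    ad≡1 = trans eq (cong (λ x → suc (x ℕ.* c)) b≡0)
    identity : ℕmat a b c d ≡ ℕmat 1 0 0 1
    identity = mat≡ (cong +_ (ℕₚ.m*n≡1⇒m≡1 a d ad≡1)) (cong +_ b≡0) (cong +_ c≡0) (cong +_ (ℕₚ.m*n≡1⇒n≡1 a d ad≡1))

-- Reduction to the axis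

±ℕmat-word : ∀ A a b c d → a ℕ.* d ≡ suc (b ℕ.* c) →
  matrix A ≡ ℕmat a b c d ⊎ matrix A ≡ neg (ℕmat a b c d) → ∃[ w ] A ≈ ⟪ w ⟫
±ℕmat-word A a b c d eq (inj₁ e) = ℕmat-word a b c d eq A e
±ℕmat-word A a b c d eq (inj₂ e) =
  let w , f = ℕmat-word a b c d eq (ℕmat a b c d , ℕdet a b c d eq) refl
  in w , P.trans (opposite e) f

OnAxis : SL₂ℤ → SL₂ℤ → Set
OnAxis M W = ∃[ w ] M · W ≈ W · ⟪ w ⟫

Hyperbolic-conj : ∀ {M V X} → M · V ≈ V · X → Hyperbolic M → Hyperbolic X
Hyperbolic-conj {M} {V} {X} e = subst (2 ℕ.<_) (∣trace∣-conj {M} {V} {X} e)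

i*i≡+∣i∣*∣i∣ : ∀ i → i * i ≡ + (∣ i ∣ ℕ.* ∣ i ∣)
i*i≡+∣i∣*∣i∣ (+ n)    = sym (ℤₚ.pos-* n n)
i*i≡+∣i∣*∣i∣ -[1+ n ] = refl

abs-cases : ∀ i → i ≡ + ∣ i ∣ ⊎ i ≡ - + ∣ i ∣
abs-cases (+ n)    = inj₁ refl
abs-cases -[1+ n ] = inj₂ refl

same-sign : ∀ x y {n} → x * y ≡ + n → (x ≡ + ∣ x ∣ × y ≡ + ∣ y ∣) ⊎ (x ≡ - + ∣ x ∣ × y ≡ - + ∣ y ∣)
same-sign (+ m)     (+ n)     _ = inj₁ (refl , refl)
same-sign -[1+ m ]  -[1+ n ]  _ = inj₂ (refl , refl)
same-sign (+ zero)  -[1+ n ]  _ = inj₂ (refl , refl)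
same-sign -[1+ m ]  (+ zero)  _ = inj₂ (refl , refl)
same-sign (+ suc m) -[1+ n ] ()
same-sign -[1+ m ] (+ suc n) ()

det≡1⇒ps≡1+qr : ∀ p q r s → p * s - q * r ≡ 1ℤ → p * s ≡ 1ℤ + q * r
det≡1⇒ps≡1+qr p q r s d = trans (regroup (p * s) (q * r)) (cong (_+ q * r) d)
  where
  regroup : ∀ x y → x ≡ x - y + y
  regroup = solve-∀

-- If b ≤ 2a, then b² ≤ 4a² ≤ 4ac, and the equation gives t² ≤ 4. In the application `a` and `c` are
-- the absolute values of the off-diagonal entries and `b` is ∣s - p∣.
discriminant-bound : ∀ {t a b c} → 2 ℕ.< t → a ℕ.≤ c → t ℕ.* t ℕ.+ 4 ℕ.* (c ℕ.* a) ≡ b ℕ.* b ℕ.+ 4 → 2 ℕ.* a ℕ.< b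
discriminant-bound {t} {a} {b} {c} t>2 a≤c eq = ℕₚ.≰⇒> λ b≤2a → ℕₚ.<⇒≱ (ℕₚ.*-mono-< t>2 t>2)
  (ℕₚ.+-cancelʳ-≤ (4 ℕ.* (c ℕ.* a)) (t ℕ.* t) 4 (begin
    t ℕ.* t ℕ.+ 4 ℕ.* (c ℕ.* a)   ≡⟨ eq ⟩
    b ℕ.* b ℕ.+ 4                 ≤⟨ ℕₚ.+-monoˡ-≤ 4 (ℕₚ.*-mono-≤ b≤2a b≤2a) ⟩
    2 ℕ.* a ℕ.* (2 ℕ.* a) ℕ.+ 4   ≡⟨ expand a ⟩
    4 ℕ.+ 4 ℕ.* (a ℕ.* a)         ≤⟨ ℕₚ.+-monoʳ-≤ 4 (ℕₚ.*-monoʳ-≤ 4 (ℕₚ.*-monoˡ-≤ a a≤c)) ⟩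
    4 ℕ.+ 4 ℕ.* (c ℕ.* a)         ∎))
  where
  open ℕₚ.≤-Reasoning
  expand : ∀ a → 2 ℕ.* a ℕ.* (2 ℕ.* a) ℕ.+ 4 ≡ 4 ℕ.+ 4 ℕ.* (a ℕ.* a)
  expand = ℕ-Solver.solve-∀

∣n-k∣<n : ∀ n k → 0 ℕ.< k → k ℕ.≤ n → ∣ + n - + k ∣ ℕ.< n
∣n-k∣<n n (suc k) _ k<n = begin-strict
  ∣ + n - + suc k ∣  ≡⟨ cong ∣_∣ (ℤₚ.m-n≡m⊖n n (suc k)) ⟩
  ∣ n ℤ.⊖ suc k ∣    ≡⟨ ℤₚ.∣m⊖n∣≡∣n⊖m∣ n (suc k) ⟩
  ∣ suc k ℤ.⊖ n ∣    ≡⟨ ℤₚ.∣⊖∣-≤ k<n ⟩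
  n ℕ.∸ suc k        <⟨ ℕₚ.∸-monoʳ-< {n} {suc k} {0} ℕ.z<s k<n ⟩
  n                  ∎
  where open ℕₚ.≤-Reasoning

-- Choosing `e` = ±1 so that `e * x` and `y` have opposite signs makes the new absolute value ∣y∣ -
-- 2∣x∣.
shift-shrinks : ∀ x y → 0 ℕ.< ∣ x ∣ → 2 ℕ.* ∣ x ∣ ℕ.< ∣ y ∣ → ∃[ e ] ∣ y + + 2 * (e * x) ∣ ℕ.< ∣ y ∣
shift-shrinks x y x≢0 x<y = choose (abs-cases x) (abs-cases y)
  where
  a b : ℤ
  a = + ∣ x ∣
  b = + ∣ y ∣
  diff : ∣ b - + 2 * a ∣ ℕ.< ∣ y ∣
  diff = subst (λ z → ∣ b - z ∣ ℕ.< ∣ y ∣) (ℤₚ.pos-* 2 ∣ x ∣)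
           (∣n-k∣<n ∣ y ∣ (2 ℕ.* ∣ x ∣) (ℕₚ.≤-trans x≢0 (ℕₚ.m≤m+n ∣ x ∣ _)) (ℕₚ.<⇒≤ x<y))
  pos : ∀ {z} → z ≡ b - + 2 * a → ∣ z ∣ ℕ.< ∣ y ∣
  pos e = subst (λ z → ∣ z ∣ ℕ.< ∣ y ∣) (sym e) diff
  negative : ∀ {z} → z ≡ - (b - + 2 * a) → ∣ z ∣ ℕ.< ∣ y ∣
  negative e = subst (ℕ._< ∣ y ∣) (trans (sym (ℤₚ.∣-i∣≡∣i∣ (b - + 2 * a))) (cong ∣_∣ (sym e))) diff
  e₁ : ∀ a b → b + + 2 * (- 1ℤ * a) ≡ b - + 2 * a
  e₁ = solve-∀
  e₂ : ∀ a b → - b + + 2 * (1ℤ * a) ≡ - (b - + 2 * a)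
  e₂ = solve-∀
  e₃ : ∀ a b → b + + 2 * (1ℤ * - a) ≡ b - + 2 * a
  e₃ = solve-∀
  e₄ : ∀ a b → - b + + 2 * (- 1ℤ * - a) ≡ - (b - + 2 * a)
  e₄ = solve-∀
  expr : ℤ → ℤ → ℤ → ℤ
  expr e x y = y + + 2 * (e * x)
  choose : x ≡ a ⊎ x ≡ - a → y ≡ b ⊎ y ≡ - b → ∃[ e ] ∣ expr e x y ∣ ℕ.< ∣ y ∣
  choose (inj₁ eqx) (inj₁ eqy) = - 1ℤ , pos (trans (cong₂ (expr (- 1ℤ)) eqx eqy) (e₁ a b))
  choose (inj₁ eqx) (inj₂ eqy) = 1ℤ , negative (trans (cong₂ (expr 1ℤ) eqx eqy) (e₂ a b))
  choose (inj₂ eqx) (inj₁ eqy) = 1ℤ , pos (trans (cong₂ (expr 1ℤ) eqx eqy) (e₃ a b))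
  choose (inj₂ eqx) (inj₂ eqy) = - 1ℤ , negative (trans (cong₂ (expr (- 1ℤ)) eqx eqy) (e₄ a b))

upper lower : ℤ → SL₂ℤ
upper e = mat 1ℤ e 0ℤ 1ℤ , d e
  where
  d : ∀ e → 1ℤ * 1ℤ - e * 0ℤ ≡ 1ℤ
  d = solve-∀
lower e = mat 1ℤ 0ℤ e 1ℤ , d e
  where
  d : ∀ e → 1ℤ * 1ℤ - 0ℤ * e ≡ 1ℤ
  d = solve-∀

-- The middle coefficient of the form (r, s - p, -q); its absolute value is the measure of the
-- descent to the axis.
middle : SL₂ℤ → ℤ
middle M = Mat.s (matrix M) - Mat.p (matrix M)

middle-upper : ∀ M e → middle (upper e ⁻¹ · M · upper e) ≡ middle M + + 2 * (e * Mat.r (matrix M))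
middle-upper (mat p q r s , _) e = eq p q r s e
  where
  eq : ∀ p q r s e →
    (- 0ℤ * p + 1ℤ * r) * e + (- 0ℤ * q + 1ℤ * s) * 1ℤ
      - ((1ℤ * p + - e * r) * 1ℤ + (1ℤ * q + - e * s) * 0ℤ)
    ≡ s - p + + 2 * (e * r)
  eq = solve-∀

middle-lower : ∀ M e → middle (lower e ⁻¹ · M · lower e) ≡ middle M + + 2 * (e * - Mat.q (matrix M))
middle-lower (mat p q r s , _) e = eq p q r s e
  where
  eq : ∀ p q r s e →
    (- e * p + 1ℤ * r) * 0ℤ + (- e * q + 1ℤ * s) * 1ℤ
      - ((1ℤ * p + - 0ℤ * r) * 1ℤ + (1ℤ * q + - 0ℤ * s) * e)
    ≡ s - p + + 2 * (e * - q)
  eq = solve-∀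

-- Two expressions of (p + s)² - 4 = (s - p)² + 4qr, with the terms placed so that both sides are
-- sums of natural numbers when q r < 0.
discriminant : ∀ M → let open Mat (matrix M) in
  trace M * trace M - + 4 * (q * r) ≡ middle M * middle M + + 4
discriminant (mat p q r s , d) = begin
  (p + s) * (p + s) - + 4 * (q * r)                    ≡⟨ eq p q r s ⟩
  (s - p) * (s - p) + + 4 * (p * s - q * r)            ≡⟨ cong (λ x → (s - p) * (s - p) + + 4 * x) d ⟩
  (s - p) * (s - p) + + 4                              ∎
  where
  open ≡-Reasoning
  eq : ∀ p q r s → (p + s) * (p + s) - + 4 * (q * r) ≡ (s - p) * (s - p) + + 4 * (p * s - q * r)
  eq = solve-∀

rotate-by-S : ∀ M → let open Mat (matrix M) in ∃[ X ] (matrix X ≡ mat s (- r) (- q) p × M · S ≈ S · X)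
rotate-by-S (mat p q r s , d) =
  (mat s (- r) (- q) p , trans (det-eq p q r s) d) , refl
  , same (mat≡ (e₁ p q) (e₂ p q r) (e₃ r s) (e₄ r s p))
  where
  det-eq : ∀ p q r s → s * p - (- r) * (- q) ≡ p * s - q * r
  det-eq = solve-∀
  e₁ : ∀ p q → p * 0ℤ + q * 1ℤ ≡ 0ℤ * s + - 1ℤ * - q
  e₁ = go s
    where
    go : ∀ s p q → p * 0ℤ + q * 1ℤ ≡ 0ℤ * s + - 1ℤ * - q
    go = solve-∀
  e₂ : ∀ p q r → p * - 1ℤ + q * 0ℤ ≡ 0ℤ * - r + - 1ℤ * p
  e₂ = solve-∀
  e₃ : ∀ r s → r * 0ℤ + s * 1ℤ ≡ 1ℤ * s + 0ℤ * - q
  e₃ = go q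
    where
    go : ∀ q r s → r * 0ℤ + s * 1ℤ ≡ 1ℤ * s + 0ℤ * - q
    go = solve-∀
  e₄ : ∀ r s p → r * - 1ℤ + s * 0ℤ ≡ 1ℤ * - r + 0ℤ * p
  e₄ = solve-∀

OnAxis-≈⟪⟫ : ∀ {M} → (∃[ w ] M ≈ ⟪ w ⟫) → ∃[ W ] OnAxis M W
OnAxis-≈⟪⟫ {M} (w , e) = I , w , P.trans (P.identityʳ M) (P.trans e (P.sym (P.identityˡ ⟪ w ⟫)))

conj-OnAxis : ∀ {M U X} → M · U ≈ U · X → (∃[ W ] OnAxis X W) → ∃[ W ] OnAxis M W
conj-OnAxis {M} {U} {X} e (W , w , f) = U · W , w , conj-trans {M} {U} {X} {W} {⟪ w ⟫} e f

-- When q r ≥ 0, conjugation by S or a change of sign makes all entries nonnegative.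
axis-meets-reduced : ∀ M {n} → Mat.q (matrix M) * Mat.r (matrix M) ≡ + n → ∃[ W ] OnAxis M W
axis-meets-reduced M@(mat p q r s , d) {n} qr≡n =
  choose (same-sign p s ps≡1+n) (same-sign q r qr≡n)
  where
  -- p s = 1 + q r is positive, so the diagonal entries share a sign; so do the off-diagonal ones,
  -- and the four combinations are treated in `choose`.
  ps≡1+n : p * s ≡ + suc n
  ps≡1+n = trans (det≡1⇒ps≡1+qr p q r s d) (cong (λ x → 1ℤ + x) qr≡n)
  ∣det∣ : ∣ p ∣ ℕ.* ∣ s ∣ ≡ suc (∣ q ∣ ℕ.* ∣ r ∣)
  ∣det∣ = trans (trans (sym (ℤₚ.abs-* p s)) (cong ∣_∣ ps≡1+n))
               (cong suc (trans (cong ∣_∣ (sym qr≡n)) (ℤₚ.abs-* q r)))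
  ∣det∣′ : ∣ s ∣ ℕ.* ∣ p ∣ ≡ suc (∣ r ∣ ℕ.* ∣ q ∣)
  ∣det∣′ = trans (ℕₚ.*-comm ∣ s ∣ ∣ p ∣) (trans ∣det∣ (cong suc (ℕₚ.*-comm ∣ q ∣ ∣ r ∣)))
  -‿pos : ∀ {x n} → x ≡ - + n → - x ≡ + n
  -‿pos {x} {n} e = trans (cong -_ e) (ℤₚ.neg-involutive (+ n))
  direct : let N = ℕmat (∣ p ∣) (∣ q ∣) (∣ r ∣) (∣ s ∣) in
           matrix M ≡ N ⊎ matrix M ≡ neg N → ∃[ W ] OnAxis M W
  direct e = OnAxis-≈⟪⟫ {M} (±ℕmat-word M (∣ p ∣) (∣ q ∣) (∣ r ∣) (∣ s ∣) ∣det∣ e)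
  rotated : let N = ℕmat (∣ s ∣) (∣ r ∣) (∣ q ∣) (∣ p ∣) in
            mat s (- r) (- q) p ≡ N ⊎ mat s (- r) (- q) p ≡ neg N → ∃[ W ] OnAxis M W
  rotated e with rotate-by-S M
  ... | X , refl , f = conj-OnAxis {M} {S} {X} f
    (OnAxis-≈⟪⟫ {X} (±ℕmat-word X (∣ s ∣) (∣ r ∣) (∣ q ∣) (∣ p ∣) ∣det∣′ e))
  choose : (p ≡ + ∣ p ∣ × s ≡ + ∣ s ∣) ⊎ (p ≡ - + ∣ p ∣ × s ≡ - + ∣ s ∣) →
           (q ≡ + ∣ q ∣ × r ≡ + ∣ r ∣) ⊎ (q ≡ - + ∣ q ∣ × r ≡ - + ∣ r ∣) → ∃[ W ] OnAxis M W
  choose (inj₁ (ep , es)) (inj₁ (eq , er)) = direct (inj₁ (mat≡ ep eq er es))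
  choose (inj₂ (ep , es)) (inj₂ (eq , er)) = direct (inj₂ (mat≡ ep eq er es))
  choose (inj₁ (ep , es)) (inj₂ (eq , er)) = rotated (inj₁ (mat≡ es (-‿pos er) (-‿pos eq) ep))
  choose (inj₂ (ep , es)) (inj₁ (eq , er)) = rotated (inj₂ (mat≡ es (cong -_ er) (cong -_ eq) ep))

-- When q r < 0, conjugation by a unipotent matrix brings down |s - p|.
middle-shrinks : ∀ M → Hyperbolic M → ∀ {n} → Mat.q (matrix M) * Mat.r (matrix M) ≡ -[1+ n ] →
  ∃[ U ] ∣ middle (U ⁻¹ · M · U) ∣ ℕ.< ∣ middle M ∣
middle-shrinks M@(mat p q r s , d) hyp {n} qr<0 = choose (ℕₚ.≤-total ∣ r ∣ ∣ q ∣)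
  where
  ∣q∣*∣r∣ : ∣ q ∣ ℕ.* ∣ r ∣ ≡ suc n
  ∣q∣*∣r∣ = trans (sym (ℤₚ.abs-* q r)) (cong ∣_∣ qr<0)
  ∣r∣*∣q∣ : ∣ r ∣ ℕ.* ∣ q ∣ ≡ suc n
  ∣r∣*∣q∣ = trans (ℕₚ.*-comm ∣ r ∣ ∣ q ∣) ∣q∣*∣r∣
  factor>0 : ∀ a b → a ℕ.* b ≡ suc n → 0 ℕ.< b
  factor>0 a (suc b) _ = ℕ.z<s
  factor>0 a zero eq with () ← trans (sym (ℕₚ.*-zeroʳ a)) eq
  -4qr : - (+ 4 * (q * r)) ≡ + (4 ℕ.* suc n)
  -4qr = cong (λ x → - (+ 4 * x)) qr<0
  abs-discriminant : ∣trace∣ M ℕ.* ∣trace∣ M ℕ.+ 4 ℕ.* suc n ≡ ∣ middle M ∣ ℕ.* ∣ middle M ∣ ℕ.+ 4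
  abs-discriminant = ℤₚ.+-injective (trans
    (cong₂ _+_ (sym (i*i≡+∣i∣*∣i∣ (trace M))) (sym -4qr))
    (trans (discriminant M) (cong (_+ + 4) (i*i≡+∣i∣*∣i∣ (middle M)))))
  bound : ∀ a c → c ℕ.* a ≡ suc n → a ℕ.≤ c → 2 ℕ.* a ℕ.< ∣ middle M ∣
  bound a c eq a≤c = discriminant-bound {∣trace∣ M} {a} {∣ middle M ∣} {c} hyp a≤c
    (trans (cong (λ x → ∣trace∣ M ℕ.* ∣trace∣ M ℕ.+ 4 ℕ.* x) eq) abs-discriminant)
  choose : ∣ r ∣ ℕ.≤ ∣ q ∣ ⊎ ∣ q ∣ ℕ.≤ ∣ r ∣ → ∃[ U ] ∣ middle (U ⁻¹ · M · U) ∣ ℕ.< ∣ middle M ∣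
  -- The bound holds for the smaller off-diagonal entry, and this decides the conjugation: `upper`
  -- shifts s - p by 2 e r, `lower` by -2 e q.
  choose (inj₁ r≤q) =
    let e , lt = shift-shrinks r (middle M) (factor>0 ∣ q ∣ ∣ r ∣ ∣q∣*∣r∣) (bound ∣ r ∣ ∣ q ∣ ∣q∣*∣r∣ r≤q)
    in upper e , subst (λ z → ∣ z ∣ ℕ.< ∣ middle M ∣) (sym (middle-upper M e)) lt
  choose (inj₂ q≤r) =
    let ∣-q∣ = sym (ℤₚ.∣-i∣≡∣i∣ q)
        e , lt = shift-shrinks (- q) (middle M)
          (subst (0 ℕ.<_) ∣-q∣ (factor>0 ∣ r ∣ ∣ q ∣ ∣r∣*∣q∣))
          (subst (λ x → 2 ℕ.* x ℕ.< ∣ middle M ∣) ∣-q∣ (bound ∣ q ∣ ∣ r ∣ ∣r∣*∣q∣ q≤r))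
    in lower e , subst (λ z → ∣ z ∣ ℕ.< ∣ middle M ∣) (sym (middle-lower M e)) lt

-- Reduction in the style of Gauss: as long as q r < 0 a conjugation lowers ∣s - p∣, and once q r ≥
-- 0 the matrix is conjugate to a word.
axis-nonempty : ∀ M → Hyperbolic M → ∃[ W ] OnAxis M W
axis-nonempty M hyp = go M hyp (<-wellFounded _)
  where
  go   : ∀ M → Hyperbolic M → Acc ℕ._<_ ∣ middle M ∣ → ∃[ W ] OnAxis M W
  step : ∀ M → Hyperbolic M → Acc ℕ._<_ ∣ middle M ∣ →
         ∀ x → Mat.q (matrix M) * Mat.r (matrix M) ≡ x → ∃[ W ] OnAxis M W
  go M hyp ac = step M hyp ac _ refl
  step M hyp _         (+ n)    qr = axis-meets-reduced M qr
  step M hyp (acc rec) -[1+ n ] qr =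
    let U , lt = middle-shrinks M hyp qr
        X = U ⁻¹ · M · U
        e = conj-by M U
    in conj-OnAxis {M} {U} {X} e (go X (Hyperbolic-conj {M} {U} {X} e hyp) (rec lt))

-- Forms and reversible matrices

form≡ : ∀ {A B C A′ B′ C′} → A ≡ A′ → B ≡ B′ → C ≡ C′ → form A B C ≡ form A′ B′ C′
form≡ refl refl refl = refl

scale : ℤ → Form → Form
scale c (form A B C) = form (c * A) (c * B) (c * C)

scale-injective : ∀ c .{{_ : NonZero c}} {f g} → scale c f ≡ scale c g → f ≡ g
scale-injective c {form A B C} {form A′ B′ C′} eq =
  form≡ (ℤₚ.*-cancelˡ-≡ c A A′ (cong Form.A eq)) (ℤₚ.*-cancelˡ-≡ c B B′ (cong Form.B eq))
        (ℤₚ.*-cancelˡ-≡ c C C′ (cong Form.C eq))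

∙-scale : ∀ c U f → U ∙ scale c f ≡ scale c (U ∙ f)
∙-scale c (mat p q r s , _) (form A B C) = form≡ (eq₁ c p r A B C) (eq₂ c p q r s A B C) (eq₁ c q s A B C)
  where
  eq₁ : ∀ c p r A B C → c * A * (p * p) + c * B * (p * r) + c * C * (r * r)
      ≡ c * (A * (p * p) + B * (p * r) + C * (r * r))
  eq₁ = solve-∀
  eq₂ : ∀ c p q r s A B C → + 2 * (c * A * (p * q)) + c * B * (p * s + q * r) + + 2 * (c * C * (r * s))
      ≡ c * (+ 2 * (A * (p * q)) + B * (p * s + q * r) + + 2 * (C * (r * s)))
  eq₂ = solve-∀

inverse-scale : ∀ c f → inverse (scale c f) ≡ scale c (inverse f)
inverse-scale c (form A B C) = form≡ refl (ℤₚ.neg-distribʳ-* c B) refl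

-- The roots of this form are the fixed points of M.
fixedPointForm : SL₂ℤ → Form
fixedPointForm M = form r (s - p) (- q)
  where open Mat (matrix M)

-- `U` carries the fixed points of `U ⁻¹ · M · U` to those of `M`, so the form changes by
-- substitution of `U`.
fixedPointForm-conj : ∀ M U → fixedPointForm (U ⁻¹ · M · U) ≡ U ∙ fixedPointForm M
fixedPointForm-conj (mat p q r s , _) (mat a b c d , _) =
  form≡ (eq₁ p q r s a c) (eq₂ p q r s a b c d) (eq₃ p q r s b d)
  where
  eq₁ : ∀ p q r s a c → (- c * p + a * r) * a + (- c * q + a * s) * c
      ≡ r * (a * a) + (s - p) * (a * c) + - q * (c * c)
  eq₁ = solve-∀
  eq₂ : ∀ p q r s a b c d →
    (- c * p + a * r) * b + (- c * q + a * s) * d - ((d * p + - b * r) * a + (d * q + - b * s) * c)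
      ≡ + 2 * (r * (a * b)) + (s - p) * (a * d + b * c) + + 2 * (- q * (c * d))
  eq₂ = solve-∀
  eq₃ : ∀ p q r s b d → - ((d * p + - b * r) * b + (d * q + - b * s) * d)
      ≡ r * (b * b) + (s - p) * (b * d) + - q * (d * d)
  eq₃ = solve-∀

fixedPointForm-θ⁻¹ : ∀ M → fixedPointForm (θ M ⁻¹) ≡ inverse (fixedPointForm M)
fixedPointForm-θ⁻¹ (mat p q r s , _) =
  form≡ (ℤₚ.neg-involutive r) (eq p s) (cong -_ (ℤₚ.neg-involutive q))
  where
  eq : ∀ p s → p - s ≡ - (s - p)
  eq = solve-∀

trace-θ⁻¹ : ∀ M → trace (θ M ⁻¹) ≡ trace M
trace-θ⁻¹ (mat p q r s , _) = ℤₚ.+-comm s p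

trace-conj : ∀ M U → trace (U ⁻¹ · M · U) ≡ trace M
trace-conj (mat p q r s , _) (mat a b c d , det≡1) =
  trans (eq p q r s a b c d) (trans (cong (_* (p + s)) det≡1) (ℤₚ.*-identityˡ (p + s)))
  where
  eq : ∀ p q r s a b c d →
    (d * p + - b * r) * a + (d * q + - b * s) * c + ((- c * p + a * r) * b + (- c * q + a * s) * d)
      ≡ (a * d - b * c) * (p + s)
  eq = solve-∀

-- The form gives q, r and s - p; together with the trace p + s it gives 2s.
fixedPointForm-trace-injective : ∀ A B → fixedPointForm A ≡ fixedPointForm B → trace A ≡ trace B → matrix A ≡ matrix B
fixedPointForm-trace-injective (mat p q r s , _) (mat p′ q′ r′ s′ , _) eq tr =
  mat≡ p≡ (ℤₚ.neg-injective (cong Form.C eq)) (cong Form.A eq) s≡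
  where
  double : ∀ p s → + 2 * s ≡ p + s + (s - p)
  double = solve-∀
  rest : ∀ p s → p ≡ p + s - s
  rest = solve-∀
  s≡ : s ≡ s′
  s≡ = ℤₚ.*-cancelˡ-≡ (+ 2) s s′ (trans (double p s) (trans (cong₂ _+_ tr (cong Form.B eq)) (sym (double p′ s′))))
  p≡ : p ≡ p′
  p≡ = trans (rest p s) (trans (cong₂ _-_ tr s≡) (sym (rest p′ s′)))

Reversible : SL₂ℤ → Set
Reversible M = ∃[ U ] M · U ≈ U · θ M ⁻¹

-- The conjugations run from `X` to `M` to `θ M ⁻¹` to `θ X ⁻¹`; the last one is the given one under
-- `θ`, inverted.
Reversible-conj : ∀ {M V X} → M · V ≈ V · X → Reversible M → Reversible X
Reversible-conj {M} {V} {X} e (U , f) =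
  V ⁻¹ · (U · θ V) ,
  conj-trans {X} {V ⁻¹} {M} {U · θ V} {θ X ⁻¹} (conj-sym {M} {V} {X} e)
    (conj-trans {M} {U} {θ M ⁻¹} {θ V} {θ X ⁻¹} f (conj-inv {θ M} {θ V} {θ X} (θ-conj {M} {V} {X} e)))

-- The substitution taking `f` to its inverse is itself the conjugator: the conjugate of `M` by it
-- has the form and the trace of `θ M ⁻¹`.
ambiguous⇒reversible : ∀ M c .{{_ : NonZero c}} f → fixedPointForm M ≡ scale c f →
                       AmbiguousForm f → Reversible M
ambiguous⇒reversible M c f eq (U , U∙f≡) =
  U , P.trans (conj-by M U) (P.∙-congˡ {U} (same (fixedPointForm-trace-injective (U ⁻¹ · M · U) (θ M ⁻¹) forms
        (trans (trace-conj M U) (sym (trace-θ⁻¹ M))))))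
  where
  open ≡-Reasoning
  forms : fixedPointForm (U ⁻¹ · M · U) ≡ fixedPointForm (θ M ⁻¹)
  forms = begin
    fixedPointForm (U ⁻¹ · M · U)  ≡⟨ fixedPointForm-conj M U ⟩
    U ∙ fixedPointForm M           ≡⟨ cong (U ∙_) eq ⟩
    U ∙ scale c f                  ≡⟨ ∙-scale c U f ⟩
    scale c (U ∙ f)                ≡⟨ cong (scale c) U∙f≡ ⟩
    scale c (inverse f)            ≡⟨ inverse-scale c f ⟨
    inverse (scale c f)            ≡⟨ cong inverse eq ⟨
    inverse (fixedPointForm M)     ≡⟨ fixedPointForm-θ⁻¹ M ⟨
    fixedPointForm (θ M ⁻¹)        ∎

-- Equality in PSL₂(ℤ) could still change the sign of the form. The two matrices have the same
-- nonzero trace, so it does not.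
reversible⇒ambiguous : ∀ M → Hyperbolic M → ∀ c .{{_ : NonZero c}} f → fixedPointForm M ≡ scale c f →
                       Reversible M → AmbiguousForm f
reversible⇒ambiguous M hyp c f eq (U , e) = U , scale-injective c (begin
    scale c (U ∙ f)                ≡⟨ ∙-scale c U f ⟨
    U ∙ scale c f                  ≡⟨ cong (U ∙_) eq ⟨
    U ∙ fixedPointForm M           ≡⟨ fixedPointForm-conj M U ⟨
    fixedPointForm (U ⁻¹ · M · U)  ≡⟨ forms (conj-unique {M} {U} {U ⁻¹ · M · U} {θ M ⁻¹} (conj-by M U) e) ⟩
    fixedPointForm (θ M ⁻¹)        ≡⟨ fixedPointForm-θ⁻¹ M ⟩
    inverse (fixedPointForm M)     ≡⟨ cong inverse eq ⟩
    inverse (scale c f)            ≡⟨ inverse-scale c f ⟩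
    scale c (inverse f)            ∎)
  where
  open ≡-Reasoning
  t≢-t : ∀ t → 2 ℕ.< ∣ t ∣ → ¬ t ≡ - t
  t≢-t (+ zero)  () _
  t≢-t (+ suc n) _  ()
  t≢-t -[1+ n ]  _  ()
  forms : U ⁻¹ · M · U ≈ θ M ⁻¹ → fixedPointForm (U ⁻¹ · M · U) ≡ fixedPointForm (θ M ⁻¹)
  forms (same f)     = cong (λ A → form (Mat.r A) (Mat.s A - Mat.p A) (- Mat.q A)) f
  forms (opposite f) = ⊥-elim (t≢-t (trace M) hyp
    (trans (sym (trace-conj M U)) (trans (trace-neg {U ⁻¹ · M · U} {θ M ⁻¹} f) (cong -_ (trace-θ⁻¹ M)))))

-- The remainder is a multiple of `j` and smaller than ∣j∣, hence zero.
i≡[i/j]*j : ∀ i j .{{_ : NonZero j}} → j Unsigned.∣ i → i ≡ i / j * j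
i≡[i/j]*j i j j∣i with divides k i≡k*j ← ∣ᵤ⇒∣ {j} {i} j∣i =
  trans (a≡a%n+[a/n]*n i j) (trans (cong (λ r → + r + i / j * j) remainder≡0) (ℤₚ.+-identityˡ (i / j * j)))
  where
  m*n<n⇒m≡0 : ∀ m {n} → m ℕ.* n ℕ.< n → m ≡ 0
  m*n<n⇒m≡0 zero        _  = refl
  m*n<n⇒m≡0 (suc m) {n} lt = ⊥-elim (ℕₚ.<⇒≱ lt (ℕₚ.m≤m+n n (m ℕ.* n)))
  isolate-remainder : ∀ i r x k j → i ≡ r + x * j → i ≡ k * j → r ≡ (k - x) * j
  isolate-remainder i r x k j e f = trans (isolate r x j) (trans (cong (_- x * j) (trans (sym e) f)) (factor k x j))
    where
    isolate : ∀ r x j → r ≡ r + x * j - x * j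
    isolate = solve-∀
    factor : ∀ k x j → k * j - x * j ≡ (k - x) * j
    factor = solve-∀
  remainder : i % j ≡ ∣ k - i / j ∣ ℕ.* ∣ j ∣
  remainder = trans (cong ∣_∣ (isolate-remainder i (+ (i % j)) (i / j) k j (a≡a%n+[a/n]*n i j) i≡k*j)) (ℤₚ.abs-* (k - i / j) j)
  remainder≡0 : i % j ≡ 0
  remainder≡0 = trans remainder (cong (ℕ._* ∣ j ∣) (m*n<n⇒m≡0 ∣ k - i / j ∣ (subst (ℕ._< ∣ j ∣) remainder (n%d<d i j))))

hyperbolic⇒content≢0 : ∀ M → Hyperbolic M → ¬ content M ≡ 0ℤ
hyperbolic⇒content≢0 M@(mat p q r s , d) hyp eq = ℕₚ.<⇒≱ hyp (begin
  ∣ p + s ∣        ≤⟨ ℤₚ.∣i+j∣≤∣i∣+∣j∣ p s ⟩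
  ∣ p ∣ ℕ.+ ∣ s ∣  ≡⟨ cong₂ ℕ._+_ (ℕₚ.m*n≡1⇒m≡1 ∣ p ∣ ∣ s ∣ ∣ps∣≡1) (ℕₚ.m*n≡1⇒n≡1 ∣ p ∣ ∣ s ∣ ∣ps∣≡1) ⟩
  2                ∎)
  where
  open ℕₚ.≤-Reasoning
  ps≡1 : p * s ≡ 1ℤ
  ps≡1 = trans (det≡1⇒ps≡1+qr p q r s d)
    (cong (λ x → 1ℤ + x * r) (gcd[i,j]≡0⇒i≡0 q (gcd (s - p) r) eq))
  ∣ps∣≡1 : ∣ p ∣ ℕ.* ∣ s ∣ ≡ 1
  ∣ps∣≡1 = trans (sym (ℤₚ.abs-* p s)) (cong ∣_∣ ps≡1)

-- The factor relating `fixedPointForm` to `form-of`; the sign is its own inverse, so multiplication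
-- by it undoes the normalization.
multiplier : SL₂ℤ → ℤ
multiplier M = (sign (trace M) ◃ 1) * content M

multiplier≢0 : ∀ M → Hyperbolic M → NonZero (multiplier M)
multiplier≢0 M hyp = ℤₚ.i*j≢0 (sign (trace M) ◃ 1) (content M)
  {{subst ℕ.NonZero (sym (ℤₚ.abs-◃ (sign (trace M)) 1)) _}} {{≢-nonZero (hyperbolic⇒content≢0 M hyp)}}

fixedPointForm-form-of : ∀ M hyp → fixedPointForm M ≡ scale (multiplier M) (form-of M hyp)
fixedPointForm-form-of M@(mat p q r s , _) hyp =
  form≡ (entry r g∣r) (entry (s - p) g∣s-p) (entry (- q) g∣-q)
  where
  g : ℤ
  g = content M
  instance
    g≢0 : NonZero g
    g≢0 = ≢-nonZero (hyperbolic⇒content≢0 M hyp)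
  g∣s-p : g Unsigned.∣ s - p
  g∣s-p = ℕ-Div.∣-trans (gcd[i,j]∣j q (gcd (s - p) r)) (gcd[i,j]∣i (s - p) r)
  g∣r : g Unsigned.∣ r
  g∣r = ℕ-Div.∣-trans (gcd[i,j]∣j q (gcd (s - p) r)) (gcd[i,j]∣j (s - p) r)
  g∣-q : g Unsigned.∣ - q
  g∣-q = subst (∣ g ∣ ℕ-Div.∣_) (sym (ℤₚ.∣-i∣≡∣i∣ q)) (gcd[i,j]∣i q (gcd (s - p) r))
  signs : ∀ σ x → x ≡ (σ ◃ 1) * (σ ◃ 1) * x
  signs Sign.+ x = sym (ℤₚ.*-identityˡ x)
  signs Sign.- x = sym (ℤₚ.*-identityˡ x)
  regroup : ∀ σ g x → σ * σ * (x * g) ≡ σ * g * (σ * x)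
  regroup = solve-∀
  entry : ∀ x → g Unsigned.∣ x → x ≡ multiplier M * ((sign (trace M) ◃ 1) * (x / g))
  entry x g∣x = trans (i≡[i/j]*j x g g∣x)
    (trans (signs (sign (trace M)) (x / g * g)) (regroup (sign (trace M) ◃ 1) g (x / g)))

-- The form `Z ∙ form-of M hyp` belongs to the conjugate `Z ⁻¹ · M · Z`, and reversibility is
-- invariant under conjugation.
class-ambiguous⇔reversible : ∀ M hyp → (∀ f → f ∈[ form-of M hyp ] → AmbiguousForm f) ⇔ Reversible M
class-ambiguous⇔reversible M hyp = mk⇔
  (λ amb → Reversible-conj {I ⁻¹ · M · I} {I ⁻¹} {M} (conj-sym {M} {I} (conj-by M I))
    (ambiguous⇒reversible (I ⁻¹ · M · I) c (I ∙ form-of M hyp) (conj-form I)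
      (amb (I ∙ form-of M hyp) (I , refl))))
  λ where
    rev f (Z , refl) → reversible⇒ambiguous (Z ⁻¹ · M · Z) (Hyperbolic-conj {M} {Z} (conj-by M Z) hyp)
      c (Z ∙ form-of M hyp) (conj-form Z) (Reversible-conj {M} {Z} (conj-by M Z) rev)
  where
  c : ℤ
  c = multiplier M
  instance
    c≢0 : NonZero c
    c≢0 = multiplier≢0 M hyp
  conj-form : ∀ Z → fixedPointForm (Z ⁻¹ · M · Z) ≡ scale c (Z ∙ form-of M hyp)
  conj-form Z = trans (fixedPointForm-conj M Z)
    (trans (cong (Z ∙_) (fixedPointForm-form-of M hyp)) (∙-scale c Z (form-of M hyp)))

-- Spines and words

SameOrbit-respects : ∀ M (Q : SL₂ℤ → Set) → (∀ {V W} → V ≈ W → Q V → Q W) →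
  (∀ V → Q V → Q (M · V)) → (∀ V → Q (M · V) → Q V) →
  ∀ {V W} → SameOrbit M V W → Q V → Q W
SameOrbit-respects M Q resp up down {V} {W} (k , e) qV = resp e (power k)
  where
  power : ∀ k → Q (M ^ k · V)
  power (+ zero)       = resp (P.sym (P.identityˡ V)) qV
  power (+ suc n)      = resp (P.sym (P.assoc M (M ^ (+ n)) V)) (up (M ^ (+ n) · V) (power (+ n)))
  power -[1+ zero ]    = down (M ⁻¹ · V) (resp (P.sym (\\-leftDividesˡ M V)) qV)
  power -[1+ suc n ]   = down (M ⁻¹ · M ^ -[1+ n ] · V)
    (resp (P.sym (P.trans (P.∙-congˡ {M} (P.assoc (M ⁻¹) (M ^ -[1+ n ]) V)) (\\-leftDividesˡ M (M ^ -[1+ n ] · V))))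
          (power -[1+ n ]))

OnAxis-cong : ∀ M {V W} → V ≈ W → OnAxis M V → OnAxis M W
OnAxis-cong M {V} {W} e (w , f) = w , P.trans (P.∙-congˡ {M} (P.sym e)) (P.trans f (P.∙-congʳ {⟪ w ⟫} e))

OnAxis-orbit : ∀ M {V W} → SameOrbit M V W → OnAxis M V → OnAxis M W
OnAxis-orbit M = SameOrbit-respects M (OnAxis M) (OnAxis-cong M)
  (λ V (w , e) → w , conj-trans {M} {M} {M} {V} {⟪ w ⟫} P.refl e)
  (λ V (w , e) → w , (begin
    M · V                        ≈⟨ \\-leftDividesʳ M (M · V) ⟨
    M ⁻¹ · (M · (M · V))         ≈⟨ P.∙-congˡ {M ⁻¹} e ⟩
    M ⁻¹ · (M · V · ⟪ w ⟫)       ≈⟨ P.∙-congˡ {M ⁻¹} (P.assoc M V ⟪ w ⟫) ⟩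
    M ⁻¹ · (M · (V · ⟪ w ⟫))     ≈⟨ \\-leftDividesʳ M (V · ⟪ w ⟫) ⟩
    V · ⟪ w ⟫                    ∎))
  where open SetoidReasoning P.setoid

turn-Farey : ∀ b e → turn Farey b e ≡ e · turning b
turn-Farey inner e = refl
turn-Farey outer e = refl

n+[1+d] : ∀ n d → n + + suc d ≡ ℤ.suc n + + d
n+[1+d] n d = eq n (+ d)
  where
  eq : ∀ n d → n + (1ℤ + d) ≡ 1ℤ + n + d
  eq = solve-∀

module _ (l : Line Farey) where
  open Line l
  open SetoidReasoning P.setoid

  enter-suc : ∀ n → enter (ℤ.suc n) ≈ enter n · letter (branch n)
  enter-suc n = begin
    enter (ℤ.suc n)                       ≈⟨ at-⊗ n ⟩
    leave n · S                           ≈⟨ P.∙-congʳ {S} (at-• n) ⟩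
    turn Farey (branch n) (enter n) · S   ≡⟨ cong (_· S) (turn-Farey (branch n) (enter n)) ⟩
    enter n · turning (branch n) · S      ≈⟨ P.assoc (enter n) (turning (branch n)) S ⟩
    enter n · letter (branch n)           ∎

  -- One step along a line is right multiplication by the letter of its turn. On a directed axis the
  -- translation by `M` is therefore right multiplication by a word.
  enter-+ : ∀ d n → ∃[ w ] enter (n + + d) ≈ enter n · ⟪ w ⟫
  enter-+ zero    n = [] , P.trans (P.reflexive (cong enter (ℤₚ.+-identityʳ n))) (P.sym (P.identityʳ (enter n)))
  enter-+ (suc d) n =
    let w , e = enter-+ d (ℤ.suc n)
    in branch n ∷ w , (begin
      enter (n + + suc d)                     ≡⟨ cong enter (n+[1+d] n d) ⟩
      enter (ℤ.suc n + + d)                   ≈⟨ e ⟩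
      enter (ℤ.suc n) · ⟪ w ⟫                 ≈⟨ P.∙-congʳ {⟪ w ⟫} (enter-suc n) ⟩
      enter n · letter (branch n) · ⟪ w ⟫     ≈⟨ P.assoc (enter n) (letter (branch n)) ⟪ w ⟫ ⟩
      enter n · ⟪ branch n ∷ w ⟫              ∎)

Spine⇒OnAxis : ∀ M hyp W → SpinedGraph.Spine (çark M hyp) W → OnAxis M W
Spine⇒OnAxis M hyp W (l , (d , _ , translates) , n , orbit) =
  let w , e = enter-+ l d n
  in OnAxis-orbit M orbit (w , P.trans (translates n) e)

-- The letters ahead of W are read off a word rotated by one letter at each
-- •-vertex; being cyclic, the word can be rotated backwards as well.
module AxisThrough (M : SL₂ℤ) (m : ℕ) (W : SL₂ℤ) (w : Vec Side (suc m))
                   (translates : M · W ≈ W · ⟪ Vec.toList w ⟫) where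
  open SetoidReasoning P.setoid

  Cycle : Set
  Cycle = Vec Side (suc m)

  rotate unrotate : Cycle → Cycle
  rotate w   = Vec.tail w Vec.∷ʳ Vec.head w
  unrotate w = Vec.last w Vec.∷ Vec.init w

  rotate-unrotate : ∀ w → rotate (unrotate w) ≡ w
  rotate-unrotate w = sym (proj₂ (proj₂ (Vec.initLast w)))

  cycle : ℤ → Cycle
  cycle (+ zero)       = w
  cycle (+ suc n)      = rotate (cycle (+ n))
  cycle -[1+ zero ]    = unrotate w
  cycle -[1+ suc n ]   = unrotate (cycle -[1+ n ])

  turn-at : ℤ → Side
  turn-at n = Vec.head (cycle n)

  -- A backward step undoes the letter at the index it arrives at, so that `edge-suc` has the same
  -- form at every integer.
  edge : ℤ → SL₂ℤ
  edge (+ zero)     = W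
  edge (+ suc n)    = edge (+ n) · letter (turn-at (+ n))
  edge -[1+ zero ]  = W · letter (turn-at -[1+ 0 ]) ⁻¹
  edge -[1+ suc n ] = edge -[1+ n ] · letter (turn-at -[1+ suc n ]) ⁻¹

  cycle-suc : ∀ n → cycle (ℤ.suc n) ≡ rotate (cycle n)
  cycle-suc (+ n)        = refl
  cycle-suc -[1+ zero ]  = sym (rotate-unrotate w)
  cycle-suc -[1+ suc n ] = sym (rotate-unrotate (cycle -[1+ n ]))

  edge-suc : ∀ n → edge (ℤ.suc n) ≈ edge n · letter (turn-at n)
  edge-suc (+ n)        = P.refl
  edge-suc -[1+ zero ]  = P.sym (//-rightDividesˡ (letter (turn-at -[1+ 0 ])) W)
  edge-suc -[1+ suc n ] = P.sym (//-rightDividesˡ (letter (turn-at -[1+ suc n ])) (edge -[1+ n ]))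

  line : Line Farey
  line = record
    { enter  = edge
    ; leave  = λ n → turn Farey (turn-at n) (edge n)
    ; branch = turn-at
    ; at-•   = λ n → P.refl
    ; at-⊗   = λ n → begin
        edge (ℤ.suc n)                        ≈⟨ edge-suc n ⟩
        edge n · letter (turn-at n)           ≈⟨ P.assoc (edge n) (turning (turn-at n)) S ⟨
        edge n · turning (turn-at n) · S      ≡⟨ cong (_· S) (turn-Farey (turn-at n) (edge n)) ⟨
        turn Farey (turn-at n) (edge n) · S   ∎
    }

  toList-rotate : ∀ {b u v} (w : Cycle) → Vec.toList w ≡ b ∷ u ++ v → Vec.toList (rotate w) ≡ u ++ (v ∷ʳ b)
  toList-rotate {b} {u} {v} (a Vec.∷ w) eq = trans (Vecₚ.toList-∷ʳ a w) (trans
    (cong₂ _∷ʳ_ (Listₚ.∷-injectiveʳ eq) (Listₚ.∷-injectiveˡ eq)) (Listₚ.++-assoc u v [ b ]))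

  head-toList : ∀ {b u} (w : Cycle) → Vec.toList w ≡ b ∷ u → Vec.head w ≡ b
  head-toList (_ Vec.∷ _) refl = refl

  -- Stated for a prefix `u` of the cycle: the letter just read moves behind `v`, which makes the
  -- rest of `u` a prefix of the rotated cycle.
  edge-+ : ∀ u v n → Vec.toList (cycle n) ≡ u ++ v → edge (n + + length u) ≈ edge n · ⟪ u ⟫
  edge-+ []      v n eq = P.trans (P.reflexive (cong edge (ℤₚ.+-identityʳ n))) (P.sym (P.identityʳ (edge n)))
  edge-+ (b ∷ u) v n eq = begin
    edge (n + + suc (length u))              ≡⟨ cong edge (n+[1+d] n (length u)) ⟩
    edge (ℤ.suc n + + length u)              ≈⟨ edge-+ u (v ∷ʳ b) (ℤ.suc n) (trans (cong Vec.toList (cycle-suc n)) (toList-rotate {b} {u} {v} (cycle n) eq)) ⟩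
    edge (ℤ.suc n) · ⟪ u ⟫                   ≈⟨ P.∙-congʳ {⟪ u ⟫} (edge-suc n) ⟩
    edge n · letter (turn-at n) · ⟪ u ⟫      ≡⟨ cong (λ b → edge n · letter b · ⟪ u ⟫) (head-toList (cycle n) eq) ⟩
    edge n · letter b · ⟪ u ⟫                ≈⟨ P.assoc (edge n) (letter b) ⟪ u ⟫ ⟩
    edge n · ⟪ b ∷ u ⟫                       ∎

  -- Conjugating a word by its first letter moves that letter to the end.
  forward : ∀ {X} (w : Cycle) → M · X ≈ X · ⟪ Vec.toList w ⟫ →
            M · (X · letter (Vec.head w)) ≈ X · letter (Vec.head w) · ⟪ Vec.toList (rotate w) ⟫
  forward {X} (b Vec.∷ w) e = conj-trans {M} {X} {⟪ b ∷ Vec.toList w ⟫} {letter b} {⟪ Vec.toList (w Vec.∷ʳ b) ⟫} e (begin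
    letter b · ⟪ Vec.toList w ⟫ · letter b    ≈⟨ P.assoc (letter b) ⟪ Vec.toList w ⟫ (letter b) ⟩
    letter b · (⟪ Vec.toList w ⟫ · letter b)  ≈⟨ P.∙-congˡ {letter b} (⟪⟫-∷ʳ (Vec.toList w) b) ⟨
    letter b · ⟪ Vec.toList w ∷ʳ b ⟫          ≡⟨ cong (λ u → letter b · ⟪ u ⟫) (Vecₚ.toList-∷ʳ b w) ⟨
    letter b · ⟪ Vec.toList (w Vec.∷ʳ b) ⟫    ∎)

  backward : ∀ {X} (w : Cycle) → M · X ≈ X · ⟪ Vec.toList (rotate w) ⟫ →
             M · (X · letter (Vec.head w) ⁻¹) ≈ X · letter (Vec.head w) ⁻¹ · ⟪ Vec.toList w ⟫
  backward {X} (b Vec.∷ w) e = conj-trans {M} {X} {⟪ Vec.toList (w Vec.∷ʳ b) ⟫} {letter b ⁻¹} {⟪ b ∷ Vec.toList w ⟫} e (begin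
    ⟪ Vec.toList (w Vec.∷ʳ b) ⟫ · letter b ⁻¹       ≡⟨ cong (λ u → ⟪ u ⟫ · letter b ⁻¹) (Vecₚ.toList-∷ʳ b w) ⟩
    ⟪ Vec.toList w ∷ʳ b ⟫ · letter b ⁻¹             ≈⟨ P.∙-congʳ {letter b ⁻¹} (⟪⟫-∷ʳ (Vec.toList w) b) ⟩
    ⟪ Vec.toList w ⟫ · letter b · letter b ⁻¹       ≈⟨ //-rightDividesʳ (letter b) ⟪ Vec.toList w ⟫ ⟩
    ⟪ Vec.toList w ⟫                                ≈⟨ \\-leftDividesʳ (letter b) ⟪ Vec.toList w ⟫ ⟨
    letter b ⁻¹ · (letter b · ⟪ Vec.toList w ⟫)     ∎)

  edge-translates : ∀ n → M · edge n ≈ edge n · ⟪ Vec.toList (cycle n) ⟫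
  edge-translates (+ zero)     = translates
  edge-translates (+ suc n)    = forward (cycle (+ n)) (edge-translates (+ n))
  edge-translates -[1+ zero ]  = backward (unrotate w)
    (P.trans translates (P.reflexive (cong (λ u → W · ⟪ Vec.toList u ⟫) (sym (rotate-unrotate w)))))
  edge-translates -[1+ suc n ] = backward (unrotate (cycle -[1+ n ]))
    (P.trans (edge-translates -[1+ n ])
      (P.reflexive (cong (λ u → edge -[1+ n ] · ⟪ Vec.toList u ⟫) (sym (rotate-unrotate (cycle -[1+ n ]))))))

  isDirectedAxis : IsDirectedAxis M line
  isDirectedAxis = suc m , ℕ.z<s , λ n → begin
    M · edge n                                  ≈⟨ edge-translates n ⟩
    edge n · ⟪ Vec.toList (cycle n) ⟫           ≈⟨ edge-+ (Vec.toList (cycle n)) [] n (sym (Listₚ.++-identityʳ _)) ⟨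
    edge (n + + length (Vec.toList (cycle n)))  ≡⟨ cong (λ d → edge (n + + d)) (Vecₚ.length-toList (cycle n)) ⟩
    edge (n + + suc m)                          ∎

OnAxis⇒Spine : ∀ M hyp W → OnAxis M W → SpinedGraph.Spine (çark M hyp) W
OnAxis⇒Spine M hyp W ([] , e) =
  -- An empty word would make `M` conjugate to the identity, whose trace is 2.
  ⊥-elim (ℕₚ.<⇒≢ hyp (sym (∣trace∣-conj {M} {W} {I} e)))
OnAxis⇒Spine M hyp W (b ∷ w , e) =
  line , isDirectedAxis , 0ℤ , 0ℤ , P.identityˡ W
  where
  open AxisThrough M (length w) W (b Vec.∷ Vec.fromList w)
    (P.trans e (P.reflexive (cong (λ u → W · ⟪ b ∷ u ⟫) (sym (Vecₚ.toList∘fromList w)))))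

-- Çarks and their mirror images

≈⇒∼ : ∀ M {V W} → V ≈ W → SameOrbit M V W
≈⇒∼ M {V} e = 0ℤ , P.trans (P.identityˡ V) e

∼-·ʳ : ∀ M {V W} g → SameOrbit M V W → SameOrbit M (V · g) (W · g)
∼-·ʳ M {V} g (k , e) = k , P.trans (P.sym (P.assoc (M ^ k) V g)) (P.∙-congʳ {g} e)

-- A map that turns the action of `M` into that of `M ⁻¹` still carries orbits of ⟨M⟩ to orbits.
∼-reversing : ∀ M (f : SL₂ℤ → SL₂ℤ) → (∀ {V W} → V ≈ W → f V ≈ f W) → (∀ V → f (M · V) ≈ M ⁻¹ · f V) →
  ∀ {V W} → SameOrbit M V W → SameOrbit M (f V) (f W)
∼-reversing M f f-cong f-M {V} orbit = SameOrbit-respects M (λ X → SameOrbit M (f V) (f X))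
  (λ e o → E.trans o (≈⇒∼ M (f-cong e)))
  (λ X o → E.trans o (back X))
  (λ X o → E.trans o (E.sym (back X)))
  orbit (E.refl {f V})
  where
  module E = Setoid (RibbonGraph.edges (Quotient M))
  back : ∀ X → SameOrbit M (f X) (f (M · X))
  back X = - 1ℤ , P.sym (f-M X)

-- From a reversing conjugation to an isomorphism with the mirror image

module FromReversible (M : SL₂ℤ) (hyp : Hyperbolic M) (U : SL₂ℤ) (reverses : M · U ≈ U · θ M ⁻¹) where
  open SetoidReasoning P.setoid
  private module E = Setoid (RibbonGraph.edges (Quotient M))

  -- `to` is the effect on edges of z ↦ -z̄ followed by `U`. The factor `S` arises because the
  -- reflection takes the arc from i to e^{iπ/3} to its image under `S`.
  τ to unτ from : SL₂ℤ → SL₂ℤ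
  τ W    = U · θ W
  to W   = τ W · S
  unτ W  = U ⁻¹ · (W · S ⁻¹)
  from W = θ (unτ W)

  τ-· : ∀ W g → τ (W · g) ≈ τ W · θ g
  τ-· W g = P.trans (P.∙-congˡ {U} (θ-· W g)) (P.sym (P.assoc U (θ W) (θ g)))

  τ-M : ∀ W → τ (M · W) ≈ M ⁻¹ · τ W
  τ-M W = begin
    U · θ (M · W)           ≈⟨ τ-· M W ⟩
    U · θ M · θ W           ≈⟨ P.∙-congʳ {θ W} (P.∙-congˡ {U} (⁻¹-involutive (θ M))) ⟨
    U · θ M ⁻¹ ⁻¹ · θ W     ≈⟨ P.∙-congʳ {θ W} (conj-inv {M} {U} {θ M ⁻¹} reverses) ⟨
    M ⁻¹ · U · θ W          ≈⟨ P.assoc (M ⁻¹) U (θ W) ⟩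
    M ⁻¹ · τ W              ∎

  to-M : ∀ W → to (M · W) ≈ M ⁻¹ · to W
  to-M W = P.trans (P.∙-congʳ {S} (τ-M W)) (P.assoc (M ⁻¹) (τ W) S)

  unτ-M : ∀ W → unτ (M · W) ≈ θ M ⁻¹ · unτ W
  unτ-M W = begin
    U ⁻¹ · (M · W · S ⁻¹)          ≈⟨ P.∙-congˡ {U ⁻¹} (P.assoc M W (S ⁻¹)) ⟩
    U ⁻¹ · (M · (W · S ⁻¹))        ≈⟨ P.assoc (U ⁻¹) M (W · S ⁻¹) ⟨
    U ⁻¹ · M · (W · S ⁻¹)          ≈⟨ P.∙-congʳ {W · S ⁻¹} (conj-sym {M} {U} {θ M ⁻¹} reverses) ⟨
    θ M ⁻¹ · U ⁻¹ · (W · S ⁻¹)     ≈⟨ P.assoc (θ M ⁻¹) (U ⁻¹) (W · S ⁻¹) ⟩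
    θ M ⁻¹ · unτ W                 ∎

  from-M : ∀ W → from (M · W) ≈ M ⁻¹ · from W
  from-M W = begin
    θ (unτ (M · W))          ≈⟨ θ-cong {unτ (M · W)} {θ M ⁻¹ · unτ W} (unτ-M W) ⟩
    θ (θ M ⁻¹ · unτ W)       ≈⟨ θ-· (θ M ⁻¹) (unτ W) ⟩
    θ (θ M ⁻¹) · from W      ≈⟨ P.∙-congʳ {from W} (P.trans (θ-⁻¹ (θ M)) (P.⁻¹-cong (θ-θ M))) ⟩
    M ⁻¹ · from W            ∎

  to-cong : ∀ {V W} → V ≈ W → to V ≈ to W
  to-cong e = P.∙-congʳ {S} (P.∙-congˡ {U} (θ-cong e))

  from-cong : ∀ {V W} → V ≈ W → from V ≈ from W
  from-cong {V} {W} e = θ-cong {unτ V} {unτ W} (P.∙-congˡ {U ⁻¹} (P.∙-congʳ {S ⁻¹} e))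

  to-from : ∀ W → to (from W) ≈ W
  to-from W = begin
    U · θ (from W) · S              ≈⟨ P.∙-congʳ {S} (P.∙-congˡ {U} (θ-θ (unτ W))) ⟩
    U · (U ⁻¹ · (W · S ⁻¹)) · S     ≈⟨ P.∙-congʳ {S} (\\-leftDividesˡ U (W · S ⁻¹)) ⟩
    W · S ⁻¹ · S                    ≈⟨ //-rightDividesˡ S W ⟩
    W                               ∎

  unτ-to : ∀ W → unτ (to W) ≈ θ W
  unτ-to W = begin
    U ⁻¹ · (τ W · S · S ⁻¹)   ≈⟨ P.∙-congˡ {U ⁻¹} (//-rightDividesʳ S (τ W)) ⟩
    U ⁻¹ · (U · θ W)          ≈⟨ \\-leftDividesʳ U (θ W) ⟩
    θ W                       ∎

  from-to : ∀ W → from (to W) ≈ W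
  from-to W = P.trans (θ-cong {unτ (to W)} {θ W} (unτ-to W)) (θ-θ W)

  to-orbit : ∀ {V W} → SameOrbit M V W → SameOrbit M (to V) (to W)
  to-orbit {V} {W} = ∼-reversing M to to-cong to-M {V} {W}

  from-orbit : ∀ {V W} → SameOrbit M V W → SameOrbit M (from V) (from W)
  from-orbit {V} {W} = ∼-reversing M from from-cong from-M {V} {W}

  bijection : Inverse (RibbonGraph.edges (Quotient M)) (RibbonGraph.edges (Quotient M))
  bijection = record
    { to        = to
    ; from      = from
    ; to-cong   = λ {V} {W} → to-orbit {V} {W}
    ; from-cong = λ {V} {W} → from-orbit {V} {W}
    ; inverse   = (λ {W} {V} e → E.trans {to V} {to (from W)} {W} (to-orbit {V} {from W} e) (≈⇒∼ M (to-from W)))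
                , (λ {W} {V} e → E.trans {from V} {from (to W)} {W} (from-orbit {V} {to W} e) (≈⇒∼ M (from-to W)))
    }

  to-σ : ∀ W → to (W · S) ≈ to W · S ⁻¹
  to-σ W = begin
    τ (W · S) · S       ≈⟨ P.∙-congʳ {S} (τ-· W S) ⟩
    τ W · θ S · S       ≈⟨ P.∙-congʳ {S} (P.∙-congˡ {τ W} {θ S} {S ⁻¹} (same refl)) ⟩
    τ W · S ⁻¹ · S      ≈⟨ //-rightDividesˡ S (τ W) ⟩
    τ W                 ≈⟨ //-rightDividesʳ S (τ W) ⟨
    τ W · S · S ⁻¹      ∎

  to-ρ : ∀ W → to (W · (R · R)) ≈ to W · (R · R) ⁻¹
  to-ρ W = begin
    τ (W · (R · R)) · S         ≈⟨ P.∙-congʳ {S} (τ-· W (R · R)) ⟩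
    τ W · θ (R · R) · S         ≈⟨ P.assoc (τ W) (θ (R · R)) S ⟩
    τ W · (θ (R · R) · S)       ≈⟨ P.∙-congˡ {τ W} (same refl) ⟩
    τ W · (S · (R · R) ⁻¹)      ≈⟨ P.assoc (τ W) S ((R · R) ⁻¹) ⟨
    τ W · S · (R · R) ⁻¹        ∎

  to-S : ∀ W → to W · S ≈ τ W
  to-S W = begin
    τ W · S · S    ≈⟨ P.assoc (τ W) S S ⟩
    τ W · (S · S)  ≈⟨ P.∙-congˡ {τ W} (opposite refl) ⟩
    τ W · I        ≈⟨ P.identityʳ (τ W) ⟩
    τ W            ∎

  -- `θ W` lies on the axis of `θ M ⁻¹`, with the reversed word, and `U` carries that axis to the
  -- axis of `M`.
  τ-OnAxis : ∀ W → OnAxis M W → OnAxis M (τ W)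
  τ-OnAxis W (w , e) = reverse w , conj-trans {M} {U} {θ M ⁻¹} {θ W} {⟪ reverse w ⟫} reverses (begin
    θ M ⁻¹ · θ W             ≈⟨ conj-inv {θ M} {θ W} {θ ⟪ w ⟫} (θ-conj {M} {W} {⟪ w ⟫} e) ⟩
    θ W · θ ⟪ w ⟫ ⁻¹         ≈⟨ P.∙-congˡ {θ W} (θ-⟪⟫⁻¹ w) ⟩
    θ W · ⟪ reverse w ⟫      ∎)

  τ-OnAxis⁻¹ : ∀ W → OnAxis M (τ W) → OnAxis M W
  τ-OnAxis⁻¹ W (w , e) = reverse w , (begin
    M · W                    ≈⟨ P.∙-cong (θ-θ M) (θ-θ W) ⟨
    θ (θ M) · θ (θ W)        ≈⟨ θ-conj {θ M} {θ W} {⟪ w ⟫ ⁻¹} reversed ⟩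
    θ (θ W) · θ (⟪ w ⟫ ⁻¹)   ≈⟨ P.∙-cong (θ-θ W) (P.trans (θ-⁻¹ ⟪ w ⟫) (θ-⟪⟫⁻¹ w)) ⟩
    W · ⟪ reverse w ⟫        ∎)
    where
    θM⁻¹-translates : θ M ⁻¹ · θ W ≈ θ W · ⟪ w ⟫
    θM⁻¹-translates = begin
      θ M ⁻¹ · θ W                    ≈⟨ P.∙-congˡ {θ M ⁻¹} (\\-leftDividesʳ U (θ W)) ⟨
      θ M ⁻¹ · (U ⁻¹ · τ W)           ≈⟨ conj-trans {θ M ⁻¹} {U ⁻¹} {M} {τ W} {⟪ w ⟫} (conj-sym {M} {U} {θ M ⁻¹} reverses) e ⟩
      U ⁻¹ · τ W · ⟪ w ⟫              ≈⟨ P.∙-congʳ {⟪ w ⟫} (\\-leftDividesʳ U (θ W)) ⟩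
      θ W · ⟪ w ⟫                     ∎
    reversed : θ M · θ W ≈ θ W · ⟪ w ⟫ ⁻¹
    reversed = P.trans (P.∙-congʳ {θ W} (P.sym (⁻¹-involutive (θ M))))
                       (conj-inv {θ M ⁻¹} {θ W} {⟪ w ⟫} θM⁻¹-translates)

  çark≅çarkʳ : AmbiguousÇark (çark M hyp)
  çark≅çarkʳ = record
    { bijection = bijection
    ; to-σ      = λ W → ≈⇒∼ M (to-σ W)
    ; to-ρ      = λ W → ≈⇒∼ M (to-ρ W)
    -- The mirrored spine tests an edge after applying σ, that is, at `to W · S`, which is `τ W`.
    ; to-Spine  = λ W → mk⇔
        (λ s → OnAxis⇒Spine M hyp (to W · S) (OnAxis-cong M (P.sym (to-S W)) (τ-OnAxis W (Spine⇒OnAxis M hyp W s))))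
        (λ s → OnAxis⇒Spine M hyp W (τ-OnAxis⁻¹ W (OnAxis-cong M (to-S W) (Spine⇒OnAxis M hyp (to W · S) s))))
    }

-- A map of edges that reverses σ and ρ also reverses the steps along a line,
-- once corrected by σ, since it turns entering edges into leaving ones.
module Reversal {c ℓ₁} (G : Group c ℓ₁) where
  open Group G
    renaming (_≈_ to _≋_; _∙_ to _•_; _⁻¹ to inv)
    using (Carrier; assoc; identityʳ; ∙-congˡ; ∙-congʳ; ε)
  private module Properties = GroupProperties G

  module Corrected {ℓ₂} {_∼_ : Carrier → Carrier → Set ℓ₂} (isEquivalence : IsEquivalence _∼_)
    (≋⇒∼ : ∀ {x y} → x ≋ y → x ∼ y) (•-congʳ : ∀ {x y} z → x ∼ y → (x • z) ∼ (y • z))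
    (f : Carrier → Carrier) (f-cong : ∀ {x y} → x ∼ y → f x ∼ f y)
    (s r : Carrier) (f-s : ∀ x → f (x • s) ∼ (f x • inv s)) (f-r : ∀ x → f (x • r) ∼ (f x • inv r))
    where

    quotient : Setoid c ℓ₂
    quotient = record { isEquivalence = isEquivalence }

    open SetoidReasoning quotient

    reversal : Carrier → Carrier
    reversal x = f x • s

    reversal-cong : ∀ {x y} → x ∼ y → reversal x ∼ reversal y
    reversal-cong e = •-congʳ s (f-cong e)

    f-inv-r : ∀ x → f (x • inv r) ∼ (f x • inv (inv r))
    f-inv-r x = begin
      f (x • inv r)                     ≈⟨ ≋⇒∼ (Properties.//-rightDividesˡ r (f (x • inv r))) ⟨
      f (x • inv r) • inv r • r         ≈⟨ •-congʳ r (f-r (x • inv r)) ⟨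
      f (x • inv r • r) • r             ≈⟨ •-congʳ r (f-cong (≋⇒∼ (Properties.//-rightDividesˡ r x))) ⟩
      f x • r                           ≈⟨ ≋⇒∼ (∙-congˡ (Properties.⁻¹-involutive r)) ⟨
      f x • inv (inv r)                 ∎

    -- The correcting `s` cancels the `inv s` produced by `f`. What remains is `f x • inv t`, which
    -- is also `reversal x` followed by `inv (t • s)`.
    reversal-step : ∀ t → (∀ x → f (x • t) ∼ (f x • inv t)) →
                    ∀ x → reversal (x • (t • s)) ∼ (reversal x • inv (t • s))
    reversal-step t f-t x = begin
      f (x • (t • s)) • s           ≈⟨ reversal-cong (≋⇒∼ (assoc x t s)) ⟨
      f (x • t • s) • s             ≈⟨ •-congʳ s (f-s (x • t)) ⟩
      f (x • t) • inv s • s         ≈⟨ ≋⇒∼ (Properties.//-rightDividesˡ s (f (x • t))) ⟩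
      f (x • t)                     ≈⟨ f-t x ⟩
      f x • inv t                   ≈⟨ ≋⇒∼ (∙-congʳ (Properties.//-rightDividesʳ s (f x))) ⟨
      f x • s • inv s • inv t       ≈⟨ ≋⇒∼ (assoc (f x • s) (inv s) (inv t)) ⟩
      f x • s • (inv s • inv t)     ≈⟨ ≋⇒∼ (∙-congˡ (Properties.⁻¹-anti-homo-∙ t s)) ⟨
      f x • s • inv (t • s)         ∎

    reversal-ε : ∀ x → reversal (x • ε) ∼ (reversal x • ε)
    reversal-ε x = begin
      reversal (x • ε)   ≈⟨ reversal-cong (≋⇒∼ (identityʳ x)) ⟩
      reversal x         ≈⟨ ≋⇒∼ (identityʳ (reversal x)) ⟨
      reversal x • ε     ∎

    reversal-• : ∀ {t u t′ u′ y} → (∀ x → reversal (x • t) ∼ (reversal x • t′)) →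
      (∀ x → reversal (x • u) ∼ (reversal x • u′)) → y ≋ t′ • u′ →
      ∀ x → reversal (x • (t • u)) ∼ (reversal x • y)
    reversal-• {t} {u} {t′} {u′} {y} on-t on-u y≋ x = begin
      reversal (x • (t • u))      ≈⟨ reversal-cong (≋⇒∼ (assoc x t u)) ⟨
      reversal (x • t • u)        ≈⟨ on-u (x • t) ⟩
      reversal (x • t) • u′       ≈⟨ •-congʳ u′ (on-t x) ⟩
      reversal x • t′ • u′        ≈⟨ ≋⇒∼ (assoc (reversal x) t′ u′) ⟩
      reversal x • (t′ • u′)      ≈⟨ ≋⇒∼ (∙-congˡ y≋) ⟨
      reversal x • y              ∎

    reversal-fixed : ∀ {x y u z} → x ∼ y → y ≋ x • u → (∀ x → reversal (x • u) ∼ (reversal x • z)) →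
                     reversal x ∼ (reversal x • z)
    reversal-fixed {x} {y} {u} {z} x∼y y≋ on-u = begin
      reversal x          ≈⟨ reversal-cong x∼y ⟩
      reversal y          ≈⟨ reversal-cong (≋⇒∼ y≋) ⟩
      reversal (x • u)    ≈⟨ on-u x ⟩
      reversal x • z      ∎

-- From an isomorphism with the mirror image to a reversing conjugation

module ToReversible (M : SL₂ℤ) (hyp : Hyperbolic M) (iso : AmbiguousÇark (çark M hyp)) where
  open _≅_ iso
  open Inverse bijection using (to; to-cong)
  open Reversal.Corrected PSL₂ℤ (Setoid.isEquivalence (RibbonGraph.edges (Quotient M)))
    (λ {V} {W} → ≈⇒∼ M {V} {W}) (λ {V} {W} → ∼-·ʳ M {V} {W}) to (λ {V} {W} → to-cong {V} {W}) S (R · R) to-σ to-ρ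
    using (reversal-step; f-inv-r; reversal-ε; reversal-•; reversal-fixed) renaming (reversal to τ)

  τ-letter : ∀ b W → SameOrbit M (τ (W · letter b)) (τ W · letter b ⁻¹)
  τ-letter inner = reversal-step (R · R) to-ρ
  τ-letter outer = reversal-step ((R · R) ⁻¹) f-inv-r

  τ-⟪⟫ : ∀ w W → SameOrbit M (τ (W · ⟪ w ⟫)) (τ W · θ ⟪ w ⟫)
  τ-⟪⟫ []      = reversal-ε
  τ-⟪⟫ (b ∷ w) = reversal-• {letter b} {⟪ w ⟫} {letter b ⁻¹} {θ ⟪ w ⟫} {θ ⟪ b ∷ w ⟫} (τ-letter b) (τ-⟪⟫ w)
    (P.trans (θ-· (letter b) ⟪ w ⟫) (P.∙-congʳ {θ ⟪ w ⟫} (θ-letter b)))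

  -- The isomorphism controls edges only up to powers of `M`, so the result is an equation with
  -- `M ^ k` for some `k`, determined later by the trace.
  τ-translates : ∀ w W → M · W ≈ W · ⟪ w ⟫ → SameOrbit M (τ W) (τ W · θ ⟪ w ⟫)
  τ-translates w W e = reversal-fixed {W} {M · W} {⟪ w ⟫} {θ ⟪ w ⟫}
    (1ℤ , P.∙-congʳ {W} {M · I} {M} (P.identityʳ M)) e (τ-⟪⟫ w)

  τ-OnAxis : ∀ W → OnAxis M W → OnAxis M (τ W)
  τ-OnAxis W a = Spine⇒OnAxis M hyp (τ W) (Equivalence.to (to-Spine W) (OnAxis⇒Spine M hyp W a))

  -- `θ ⟪ w ⟫` is the inverse of a word, so `u` followed by that word would be trivial.
  ⟪⟫≈θ⟪⟫⇒[] : ∀ u w → ⟪ u ⟫ ≈ θ ⟪ w ⟫ → u ≡ []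
  ⟪⟫≈θ⟪⟫⇒[] u w e = Listₚ.++-conicalˡ u (reverse w) (⟪⟫≈I⇒[] (u ++ reverse w) (begin
    ⟪ u ++ reverse w ⟫                 ≈⟨ ⟪⟫-++ u (reverse w) ⟩
    ⟪ u ⟫ · ⟪ reverse w ⟫              ≈⟨ P.∙-congʳ {⟪ reverse w ⟫} {⟪ u ⟫} {θ ⟪ w ⟫} e ⟩
    θ ⟪ w ⟫ · ⟪ reverse w ⟫            ≈⟨ P.∙-congʳ {⟪ reverse w ⟫} {θ ⟪ w ⟫} {⟪ reverse w ⟫ ⁻¹} (θ-⟪⟫ w) ⟩
    ⟪ reverse w ⟫ ⁻¹ · ⟪ reverse w ⟫   ≈⟨ P.inverseˡ ⟪ reverse w ⟫ ⟩
    I                                  ∎))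
    where open SetoidReasoning P.setoid

  forward-impossible : ∀ {V u w} → M · V ≈ V · ⟪ u ⟫ → ¬ M · V ≈ V · θ ⟪ w ⟫
  forward-impossible {V} {u} {w} e f = ℕₚ.<⇒≢ hyp (sym (trans (∣trace∣-conj {M} {V} {⟪ u ⟫} e)
    (cong (λ u → ∣trace∣ ⟪ u ⟫) (⟪⟫≈θ⟪⟫⇒[] u w (conj-unique {M} {V} {⟪ u ⟫} {θ ⟪ w ⟫} e f)))))

  backward-reverses : ∀ {V W w} → M · W ≈ W · ⟪ w ⟫ → M ⁻¹ · V ≈ V · θ ⟪ w ⟫ → Reversible M
  -- `V` conjugates `M` to `θ ⟪ w ⟫ ⁻¹`, and `θ W ⁻¹` conjugates this to `θ M ⁻¹`.
  backward-reverses {V} {W} {w} e f = V · θ W ⁻¹ ,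
    conj-trans {M} {V} {θ ⟪ w ⟫ ⁻¹} {θ W ⁻¹} {θ M ⁻¹}
      (P.trans (P.∙-congʳ {V} {M} {M ⁻¹ ⁻¹} (P.sym (⁻¹-involutive M))) (conj-inv {M ⁻¹} {V} {θ ⟪ w ⟫} f))
      (conj-sym {θ M ⁻¹} {θ W} {θ ⟪ w ⟫ ⁻¹} (conj-inv {θ M} {θ W} {θ ⟪ w ⟫} (θ-conj {M} {W} {⟪ w ⟫} e)))

  reversible : Reversible M
  reversible =
    let W , w , e = axis-nonempty M hyp
        k , f     = τ-translates w W e
    in go W w e (τ-OnAxis W (w , e)) k f
         -- `θ` keeps the diagonal, so `θ ⟪ w ⟫` and `⟪ w ⟫` have the same trace by definition.
         (∣trace-^∣≡⇒±1 M hyp k (trans (∣trace∣-conj {M ^ k} {τ W} {θ ⟪ w ⟫} f) (sym (∣trace∣-conj {M} {W} {⟪ w ⟫} e))))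
    where
    go : ∀ W w → M · W ≈ W · ⟪ w ⟫ → OnAxis M (τ W) →
         ∀ k → M ^ k · τ W ≈ τ W · θ ⟪ w ⟫ → k ≡ 1ℤ ⊎ k ≡ - 1ℤ → Reversible M
    go W w e (u , g) _ f (inj₁ refl) = ⊥-elim (forward-impossible {τ W} {u} {w} g
      (P.trans (P.∙-congʳ {τ W} {M} {M · I} (P.sym (P.identityʳ M))) f))
    go W w e _ _ f (inj₂ refl) = backward-reverses {τ W} {W} {w} e f

corollary4p7 : (M : SL₂ℤ) (hyp : Hyperbolic M) →
    AmbiguousÇark (çark M hyp) ⇔ (∀ f → f ∈[ form-of M hyp ] → AmbiguousForm f)
corollary4p7 M hyp = mk⇔
  (λ iso → Equivalence.from (class-ambiguous⇔reversible M hyp) (ToReversible.reversible M hyp iso))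
  (λ amb → let U , e = Equivalence.to (class-ambiguous⇔reversible M hyp) amb
           in FromReversible.çark≅çarkʳ M hyp U e)
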